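{- Let $\sigma,\tau,\bar\sigma,\bar\tau$ satisfy the Standing Hypothesis and let $a\ge2$, $n\ge2$ be integers. Then $$\begin{aligned} &\{\sigma,a^n,\tau\,|\,\bar\sigma,1^{n-1},\bar\tau\}-\{\sigma,a+1,a^{n-2},a-1,\tau\,|\,\bar\sigma,1^{n-1},\bar\tau\}\\ &=\sum_{k=1}^{\lfloor n/2\rfloor}\{\sigma,ka,ka,a^{n-2k},\tau\,|\,\bar\sigma,ka,1^{n-2k},\bar\tau\}\\ &\quad+\sum_{k=1}^{\lfloor (n-1)/2\rfloor}\{\sigma,a+1,a^{n-2k-1},ka,ka-1+\tau_1,\tau\backslash\tau_1\,|\,\bar\sigma,1^{n-2k},ka,\bar\tau\backslash\bar\tau_1\}\\ &\quad+\sum_{k=1}^{\lfloor (n-1)/2\rfloor}\{\sigma,ka+1,(k+1)a-1,a^{n-2k-1},\tau\,|\,\bar\sigma,ka+1,1^{n-2k-1},\bar\tau\}\\ &\quad+\sum_{k=1}^{\lfloor (n-2)/2\rfloor}\{\sigma,a+1,a^{n-2k-2},(k+1)a-1,ka+\tau_1,\tau\backslash\tau_1\,|\,\bar\sigma,1^{n-2k-1},ka+1,\bar\tau\backslash\bar\tau_1\}\\ &\quad+\begin{cases}\{\sigma,\tfrac{n+1}{2}a,\tfrac{n-1}{2}a+\tau_1,\tau\backslash\tau_1\,|\,\bar\sigma,\tfrac{n-1}{2}a+1,\bar\tau\backslash\bar\tau_1\}&\text{if $n$ is odd},\\[1mm] \{\sigma,\tfrac n2a+1,\tfrac n2a-1+\tau_1,\tau\backslash\tau_1\,|\,\bar\sigma,\tfrac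 n2a,\bar\tau\backslash\bar\tau_1\}&\text{if $n$ is even}.\end{cases} \end{aligned}$$ If $s=0$, $\sigma$ and $\bar\sigma$ are omitted from every expression. If $t=0$, the terms in the second, fourth and final (case-defined) lines of the right-hand side (all terms containing $\tau\backslash\tau_1$) are omitted, and $\tau,\bar\tau$ are omitted from the remaining terms. If $t=1$, $\tau\backslash\tau_1$ and $\bar\tau\backslash\bar\tau_1$ are empty. The right-hand side has $2n-2$ terms when $t>0$ and $n-1$ terms when $t=0$.
   Context: Overlap notation: for $\alpha=(\alpha_1,\dots,\alpha_L)$ with $\alpha_i\ge1$ and $\beta=(\beta_1,\dots,\beta_{L-1})$ with $0\le\beta_i\le\min\{\alpha_i,\alpha_{i+1}\}$, $(\alpha\,|\,\beta)$ is the skew diagram $\lambda/\mu$ (boxes $(i,j)$ with $\mu_i<j\le\lambda_i$, identified up to deleting empty rows/columns) with $L$ nonempty rows, $\lambda_i-\mu_i=\alpha_i$, $\lambda_{i+1}-\mu_i=\beta_i$ (row $i$ has $\alpha_i$ boxes, rows $i,i+1$ share $\beta_i$ columns); $\{\alpha\,|\,\beta\}=s_{\lambda/\mu}$ is its skew Schur function (generating function of semistandard Young tableaux of that shape). Commas denote concatenation of sequences; $a^j$ denotes $j$ copies of $a$ (empty if $j=0$). Standing Hypothesis: $\sigma=(\sigma_1,\dots,\sigma_s)$, $\tau=(\tau_1,\dots,\tau_t)$ compositions, $s,t\ge0$; $\bar\sigma,\bar\tau$ sequences of non-negative integers of lengths $s,t$; $\bar\sigma_s=1$ if $s>0$; $\bar\tau_1=1$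 if $t>0$; $\bar\sigma_i\le\min\{\sigma_i,\sigma_{i+1}\}$ ($1\le i<s$), $\bar\tau_i\le\min\{\tau_i,\tau_{i-1}\}$ ($1<i\le t$). $\tau\backslash\tau_1$ removes the first part of $\tau$ and $\bar\tau\backslash\bar\tau_1$ the first entry of $\bar\tau$. -}

module Defs where

open import Algebra.Bundles using (AbelianGroup)
open import Algebra.Construct.Pointwise using (abelianGroup)
open import Data.Fin.Base as Fin using (Fin; toℕ)
import Data.Fin.Properties as Fin
open import Data.Integer.Base using (ℤ; +_)
open import Data.Integer.Properties using (+-0-abelianGroup)
open import Data.List.Base as List
  using (List; []; _∷_; _++_; map; foldr; filter; length; allFin; applyUpTo; cartesianProductWith)
open import Data.List.Relation.Unary.All using (All; []; _∷_)
open import Data.Nat.Base using (ℕ; zero; suc; _+_; _∸_; _⊓_; _≤_; _<_)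
import Data.Nat.Properties as ℕ
open import Data.Product.Base using (_×_; _,_)
open import Data.Unit.Base using (⊤; tt)
open import Data.Vec.Base as Vec using (Vec; []; _∷_; lookup; toList)
open import Data.Vec.Relation.Unary.Linked using (Linked; linked?)
open import Relation.Binary.PropositionalEquality using (_≡_)
open import Relation.Nullary.Decidable using (Dec; yes; _×-dec_; _→-dec_)

-- The row occupies columns offset + 1 , … , offset + size; in terms of λ/μ,
-- offset = μᵢ and offset + size = λᵢ.
record Row : Set where
  constructor row
  field
    offset size : ℕ

open Row public

-- Rows from top to bottom (English convention).
Diagram : Set
Diagram = List Row

-- Overlap notation (α | β): row lengths α and overlaps β.
infix 4 _∥_

record Shape : Set where
  constructor _∥_
  field
    rowLengths overlaps : List ℕ

-- The last row starts in column 1 (μ_L = 0), which fixes λ/μ up to deleting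
-- empty columns; going upwards, λᵢ₊₁ − μᵢ = βᵢ determines μᵢ.  This is the
-- intended diagram when length α = length β + 1, all αᵢ ≥ 1 and
-- βᵢ ≤ αᵢ ⊓ αᵢ₊₁; then the subtraction is never truncated.  On other
-- inputs the value is irrelevant (missing overlaps are read as 0).
placeAbove : ℕ → ℕ → Diagram → Diagram
placeAbove a b []      = row 0 a ∷ []
placeAbove a b (r ∷ D) = row ((offset r + size r) ∸ b) a ∷ r ∷ D

diagram : Shape → Diagram
diagram ([]    ∥ β)     = []
diagram (a ∷ α ∥ [])    = placeAbove a 0 (diagram (α ∥ []))
diagram (a ∷ α ∥ b ∷ β) = placeAbove a b (diagram (α ∥ β))

Filling : ℕ → Diagram → Set
Filling m = All (λ r → Vec (Fin m) (size r))

-- Entries increase strictly down each column shared by a row and the row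
-- below it.
ColumnStrict : ∀ {m} (r r′ : Row) → Vec (Fin m) (size r) → Vec (Fin m) (size r′) → Set
ColumnStrict r r′ u v = ∀ p q → offset r + toℕ p ≡ offset r′ + toℕ q → lookup u p Fin.< lookup v q

-- In a skew diagram every column is contiguous, so it suffices to compare
-- adjacent rows.
SemiStandard : ∀ {m} (D : Diagram) → Filling m D → Set
SemiStandard []           []          = ⊤
SemiStandard (r ∷ [])     (u ∷ [])    = Linked Fin._≤_ u
SemiStandard (r ∷ r′ ∷ D) (u ∷ v ∷ T) =
  Linked Fin._≤_ u × ColumnStrict r r′ u v × SemiStandard (r′ ∷ D) (v ∷ T)

semiStandard? : ∀ {m} (D : Diagram) (T : Filling m D) → Dec (SemiStandard D T)
semiStandard? []           []          = yes tt
semiStandard? (r ∷ [])     (u ∷ [])    = linked? Fin._≤?_ u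
semiStandard? (r ∷ r′ ∷ D) (u ∷ v ∷ T) =
  linked? Fin._≤?_ u
  ×-dec Fin.all? (λ p → Fin.all? (λ q →
    (offset r + toℕ p ℕ.≟ offset r′ + toℕ q) →-dec (lookup u p Fin.<? lookup v q)))
  ×-dec semiStandard? (r′ ∷ D) (v ∷ T)

entries : ∀ {m} (D : Diagram) → Filling m D → List (Fin m)
entries []      []      = []
entries (r ∷ D) (u ∷ T) = toList u ++ entries D T

-- The exponent vector e₁ ∷ ⋯ ∷ eₘ ∷ [] stands for x₁^e₁ ⋯ xₘ^eₘ, a monomial
-- in the infinitely many variables x₁, x₂, ….
Monomial : Set
Monomial = List ℕ

HasContent : (w : Monomial) (D : Diagram) → Filling (length w) D → Set
HasContent w D T = ∀ i → length (filter (i Fin.≟_) (entries D T)) ≡ List.lookup w i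

hasContent? : ∀ w (D : Diagram) (T : Filling (length w) D) → Dec (HasContent w D T)
hasContent? w D T = Fin.all? λ i → length (filter (i Fin.≟_) (entries D T)) ℕ.≟ List.lookup w i

words : ∀ m n → List (Vec (Fin m) n)
words m zero    = [] ∷ []
words m (suc n) = cartesianProductWith _∷_ (allFin m) (words m n)

fillings : ∀ m (D : Diagram) → List (Filling m D)
fillings m []      = [] ∷ []
fillings m (r ∷ D) = cartesianProductWith _∷_ (words m (size r)) (fillings m D)

-- Formal power series over ℤ, given by their coefficients, as an additive
-- group.  Trailing zeros in an exponent vector do not change the monomial;
-- the series used below take equal values on such vectors.
seriesGroup : AbelianGroup _ _
seriesGroup = abelianGroup Monomial +-0-abelianGroup

open AbelianGroup seriesGroup public
  using (_≈_)
  renaming (Carrier to Series; ε to 𝟘; _∙_ to infixl 6 _⊕_; _-_ to infixl 6 _⊖_)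

-- A tableau whose content is supported on x₁ , … , xₘ has all its entries
-- among the first m letters, so it is enough to enumerate those.
schur : Shape → Series
schur S w = + length (filter (λ T → semiStandard? D T ×-dec hasContent? w D T) (fillings (length w) D))
  where
  D : Diagram
  D = diagram S

∑ : List Shape → Series
∑ Ss = foldr _⊕_ 𝟘 (map schur Ss)

-- f 1 , … , f N
terms : ℕ → (ℕ → Shape) → List Shape
terms N f = map f (applyUpTo suc N)

-- Terms involving the first part and the remaining parts of τ; they are
-- omitted when τ is empty.
withFirst : ∀ {t} → Vec ℕ t → (ℕ → List ℕ → List Shape) → List Shape
withFirst []       f = []
withFirst (τ₁ ∷ τ) f = f τ₁ (toList τ)

record Hypothesis {s t : ℕ} (σ σ̄ : Vec ℕ s) (τ τ̄ : Vec ℕ t) : Set where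
  field
    σ-positive : ∀ i → 1 ≤ lookup σ i
    τ-positive : ∀ i → 1 ≤ lookup τ i
    σ̄-last     : ∀ i → suc (toℕ i) ≡ s → lookup σ̄ i ≡ 1
    τ̄-first    : ∀ i → toℕ i ≡ 0 → lookup τ̄ i ≡ 1
    σ̄-bound    : ∀ i j → toℕ j ≡ suc (toℕ i) → lookup σ̄ i ≤ lookup σ i ⊓ lookup σ j
    τ̄-bound    : ∀ i j → toℕ i ≡ suc (toℕ j) → lookup τ̄ i ≤ lookup τ i ⊓ lookup τ j

{-# OPTIONS --safe #-}

-- Exchanging the tails of two adjacent rows at their first failure of column
-- strictness shows, for rows x, y overlapping in c columns,
--   {σ,x,y,τ | σ̄,c,τ̄} = {σ,x | σ̄} {y,τ | τ̄} − h_{c−1} {σ,x+y−c+1,τ | σ̄,τ̄}.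
-- With it every diagram on the right-hand side becomes a combination of products
-- of ribbon-like pieces, and the case c = 1 gives recursions for those pieces.
-- All these recursions have the form Y_k(m+1) = x_k z_m − Y_{k+1}(m), so that
-- alternating convolutions of the pieces telescope to the left-hand side.
-- Here Schur functions are generating functions in a polynomial ring, and linear
-- functionals on it give the coefficients of the formal series.

module Submission where

-- An exchange of tails keeps the last letter of the upper row and the first e + 1 letters of the
-- lower row, where e counts the boxes of the lower row to the left of the overlap. The rest of the
-- diagram may depend on these letters only; this is where σ̄ ending in 1 and τ̄ beginning with 1
-- enter. Expanding each half of the left-hand side along its own recursion gives a sum with
-- alternating signs in which no shape of the theorem is visible. The remedy is to insert two
-- further convolutions, which cancel at the start because {σ,a+1,a^m,τ} may be cut from the top or
-- from the bottom. The four convolutions together are self-reproducing: once their leading products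
-- are removed, the recursions turn the remainder into the same combination with the long row grown
-- by a and with two rows of length a fewer. Each turn releases the four terms of the theorem that
-- share one value of k. The process ends with m = 0 or m = 1, which causes the two parities and the
-- final line.

open import Algebra.Bundles using (CommutativeRing)
open import Data.Bool.Base using (Bool; true; false; if_then_else_; _∧_)
open import Data.Fin.Base as Fin using (Fin; toℕ)
import Data.Fin.Properties as Fin
open import Data.Integer.Base as ℤ using (ℤ; -[1+_])
import Data.Integer.Properties as ℤ
open import Data.List.Base as List
  using (List; []; _∷_; _++_; [_]; allFin; applyUpTo; cartesianProductWith; drop; filter; length; map; replicate)
import Data.List.Properties as List
open import Data.List.Relation.Unary.All using ([]; _∷_)
open import Data.Maybe.Base using (Maybe; just; nothing)
open import Data.Nat.Base as ℕ using (ℕ; zero; suc; z≤n; s≤s)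
open import Data.Nat.Divisibility using (_∣_; _∣?_; divides)
import Data.Nat.Properties as ℕ
open import Data.Nat.Tactic.RingSolver using (solve-∀)
open import Data.Product.Base using (∃; _×_; _,_)
open import Data.Sum.Base using (_⊎_; inj₁; inj₂)
open import Data.Unit.Base using (⊤; tt)
open import Data.Vec.Base as Vec using (Vec; []; _∷_; lookup; toList)
import Data.Vec.Properties as Vec
open import Data.Vec.Relation.Unary.Linked using (linked?)
open import Defs hiding (_≈_)
open import Function.Base using (case_of_)
open import Function.Bundles using (mk⇔)
open import Level using (Lift; lift)
open import Relation.Binary.PropositionalEquality as ≡ using (_≡_)
open import Relation.Nullary.Decidable
  using (Dec; does; yes; no; dec-false; dec-true; does-⇔; map′; _×-dec_; _→-dec_)
open import Relation.Nullary.Negation using (¬_; contradiction)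
open import Relation.Unary using (Decidable; Pred)

-- With integer coefficients, whose equality is decidable, the ring solver can cancel x − x.
module IntegerCoefficients {c ℓ} (R : CommutativeRing c ℓ) where
  open CommutativeRing R
  open import Algebra.Properties.Ring ring
  open import Algebra.Properties.AbelianGroup +-abelianGroup using (⁻¹-∙-comm)
  open import Algebra.Properties.Semiring.Mult semiring using (×-homo-+; ×1-homo-*; ×-homo-1) renaming (_×_ to _⋆_)
  open import Algebra.Solver.Ring.AlmostCommutativeRing
  open import Relation.Binary.Reasoning.Setoid setoid

  private
    fromℤ : ℤ → Carrier
    fromℤ (ℤ.+ n)    = n ⋆ 1#
    fromℤ -[1+ n ] = - (suc n ⋆ 1#)

    fromℤ-neg : ∀ i → fromℤ (ℤ.- i) ≈ - fromℤ i
    fromℤ-neg (ℤ.+ zero)    = sym -0#≈0#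
    fromℤ-neg (ℤ.+ (suc n)) = refl
    fromℤ-neg -[1+ n ]    = sym (-‿involutive _)

    fromℤ-⊖ : ∀ m n → fromℤ (m ℤ.⊖ n) ≈ m ⋆ 1# - n ⋆ 1#
    fromℤ-⊖ m       zero    = sym (trans (+-congˡ -0#≈0#) (+-identityʳ _))
    fromℤ-⊖ zero    (suc n) = sym (+-identityˡ _)
    fromℤ-⊖ (suc m) (suc n) = begin
      fromℤ (suc m ℤ.⊖ suc n)                    ≡⟨ ≡.cong fromℤ (ℤ.[1+m]⊖[1+n]≡m⊖n m n) ⟩
      fromℤ (m ℤ.⊖ n)                            ≈⟨ fromℤ-⊖ m n ⟩
      m ⋆ 1# - n ⋆ 1#                            ≈⟨ +-congʳ (+-identityˡ _) ⟨
      (0# + m ⋆ 1#) - n ⋆ 1#                     ≈⟨ +-congʳ (+-congʳ (-‿inverseʳ 1#)) ⟨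
      ((1# - 1#) + m ⋆ 1#) - n ⋆ 1#              ≈⟨ +-congʳ (trans (+-assoc _ _ _) (+-congˡ (+-comm _ _))) ⟩
      (1# + (m ⋆ 1# - 1#)) - n ⋆ 1#              ≈⟨ +-congʳ (+-assoc _ _ _) ⟨
      ((1# + m ⋆ 1#) - 1#) - n ⋆ 1#              ≈⟨ +-assoc _ _ _ ⟩
      (1# + m ⋆ 1#) + (- 1# - n ⋆ 1#)            ≈⟨ +-congˡ (⁻¹-∙-comm _ _) ⟩
      (1# + m ⋆ 1#) - (1# + n ⋆ 1#)              ∎

    fromℤ-+ : ∀ i j → fromℤ (i ℤ.+ j) ≈ fromℤ i + fromℤ j
    fromℤ-+ (ℤ.+ m)    (ℤ.+ n)    = ×-homo-+ 1# m n
    fromℤ-+ (ℤ.+ m)    -[1+ n ] = fromℤ-⊖ m (suc n)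
    fromℤ-+ -[1+ m ] (ℤ.+ n)    = trans (fromℤ-⊖ n (suc m)) (+-comm _ _)
    fromℤ-+ -[1+ m ] -[1+ n ] = begin
      - (suc (suc (m ℕ.+ n)) ⋆ 1#)        ≡⟨ ≡.cong (λ k → - (suc k ⋆ 1#)) (≡.sym (ℕ.+-suc m n)) ⟩
      - ((suc m ℕ.+ suc n) ⋆ 1#)          ≈⟨ -‿cong (×-homo-+ 1# (suc m) (suc n)) ⟩
      - (suc m ⋆ 1# + suc n ⋆ 1#)         ≈⟨ ⁻¹-∙-comm _ _ ⟨
      - (suc m ⋆ 1#) - suc n ⋆ 1#         ∎

    fromℤ-*+ : ∀ i n → fromℤ (i ℤ.* ℤ.+ n) ≈ fromℤ i * fromℤ (ℤ.+ n)
    fromℤ-*+ (ℤ.+ m)    n = trans (reflexive (≡.cong fromℤ (≡.sym (ℤ.pos-* m n)))) (×1-homo-* m n)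
    fromℤ-*+ -[1+ m ] n = begin
      fromℤ (-[1+ m ] ℤ.* ℤ.+ n)               ≡⟨ ≡.cong fromℤ (ℤ.neg-distribˡ-* (ℤ.+ suc m) (ℤ.+ n)) ⟨
      fromℤ (ℤ.- (ℤ.+ suc m ℤ.* ℤ.+ n))          ≈⟨ fromℤ-neg (ℤ.+ suc m ℤ.* ℤ.+ n) ⟩
      - fromℤ (ℤ.+ suc m ℤ.* ℤ.+ n)              ≈⟨ -‿cong (fromℤ-*+ (ℤ.+ suc m) n) ⟩
      - (fromℤ (ℤ.+ suc m) * fromℤ (ℤ.+ n))      ≈⟨ -‿distribˡ-* _ _ ⟩
      - fromℤ (ℤ.+ suc m) * fromℤ (ℤ.+ n)        ∎

    fromℤ-* : ∀ i j → fromℤ (i ℤ.* j) ≈ fromℤ i * fromℤ j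
    fromℤ-* i (ℤ.+ n)    = fromℤ-*+ i n
    fromℤ-* i -[1+ n ] = begin
      fromℤ (i ℤ.* -[1+ n ])             ≡⟨ ≡.cong fromℤ (ℤ.neg-distribʳ-* i (ℤ.+ suc n)) ⟨
      fromℤ (ℤ.- (i ℤ.* ℤ.+ suc n))        ≈⟨ fromℤ-neg (i ℤ.* ℤ.+ suc n) ⟩
      - fromℤ (i ℤ.* ℤ.+ suc n)            ≈⟨ -‿cong (fromℤ-*+ i (suc n)) ⟩
      - (fromℤ i * fromℤ (ℤ.+ suc n))      ≈⟨ -‿distribʳ-* _ _ ⟩
      fromℤ i * - fromℤ (ℤ.+ suc n)        ∎

    acr : AlmostCommutativeRing c ℓ
    acr = fromCommutativeRing R

    morphism : ℤ.+-*-rawRing -Raw-AlmostCommutative⟶ acr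
    morphism = record
      { ⟦_⟧    = fromℤ
      ; +-homo = fromℤ-+
      ; *-homo = fromℤ-*
      ; -‿homo = fromℤ-neg
      ; 0-homo = refl
      ; 1-homo = ×-homo-1 1#
      }

    _coeff≟_ : ∀ i j → Maybe (fromℤ i ≈ fromℤ j)
    i coeff≟ j with i ℤ.≟ j
    ... | yes ≡.refl = just refl
    ... | no  _      = nothing

  open import Algebra.Solver.Ring ℤ.+-*-rawRing acr morphism _coeff≟_ public
    using (solve; con; _:=_; _:+_; _:*_; _:-_; :-_)

-- Alternating convolutions

-- Recursive, so that `double (suc N) + r` exposes two successors by computation, as a turn of the
-- telescope consumes them.
double : ℕ → ℕ
double zero    = zero
double (suc n) = suc (suc (double n))

-- Here n is 2N + r + 2 with r the parity and `suc j` is the summation index k of the theorem, so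
-- the left-hand side is n - 2k.
remainder : ∀ N r j → j ℕ.≤ N → suc (suc (double N ℕ.+ r)) ℕ.∸ 2 ℕ.* suc j ≡ double (N ℕ.∸ j) ℕ.+ r
remainder N r j j≤N = ≡.trans (≡.cong (suc (suc (double N ℕ.+ r)) ℕ.∸_) (ℕ.*-suc 2 j)) (go N j j≤N)
  where
  go : ∀ N j → j ℕ.≤ N → double N ℕ.+ r ℕ.∸ 2 ℕ.* j ≡ double (N ℕ.∸ j) ℕ.+ r
  go N       zero    _           = ≡.refl
  go (suc N) (suc j) (ℕ.s≤s j≤N) = ≡.trans (≡.cong (double (suc N) ℕ.+ r ℕ.∸_) (ℕ.*-suc 2 j)) (go N j j≤N)


remainder-last : ∀ N r → suc (suc (double N ℕ.+ r)) ℕ.∸ 2 ℕ.* suc N ≡ r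
remainder-last N r = ≡.trans (remainder N r N ℕ.≤-refl) (≡.cong (λ i → double i ℕ.+ r) (ℕ.n∸n≡0 N))

remainder-≥2 : ∀ N r j → j ℕ.< N → ∃ λ i → suc (suc (double N ℕ.+ r)) ℕ.∸ 2 ℕ.* suc j ≡ suc (suc i)
remainder-≥2 N r j j<N with N ℕ.∸ j | ℕ.m<n⇒0<n∸m j<N | remainder N r j (ℕ.<⇒≤ j<N)
... | suc i | _ | eq = double i ℕ.+ r , eq

module Alternating {c ℓ} (R : CommutativeRing c ℓ) where
  open CommutativeRing R hiding (zero)
  open IntegerCoefficients R
  open import Relation.Binary.Reasoning.Setoid setoid

  -- alternate d k m = ± d (k + m)  and  convolve x y k m = Σ_j (-1)^j x (k + j) y (m - j).
  alternate : (ℕ → Carrier) → ℕ → ℕ → Carrier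
  alternate d k zero    = d k
  alternate d k (suc m) = - alternate d (suc k) m

  convolve : (ℕ → Carrier) → (ℕ → Carrier) → ℕ → ℕ → Carrier
  convolve x y k zero    = x k * y zero
  convolve x y k (suc m) = x k * y (suc m) - convolve x y (suc k) m

  -- The shape of every recursion obtained by cutting a ribbon beside its long row: `x k` is the
  -- piece with the long row, `z m` the other piece. In the subtracted term the long row has
  -- swallowed its neighbour of length a, whence `suc k`.
  record Chain (z x : ℕ → Carrier) (Y : ℕ → ℕ → Carrier) : Set ℓ where
    constructor chain
    field unfold : ∀ k m → Y k (suc m) ≈ x k * z m - Y (suc k) m

  open Chain

  convolve-congʳ : ∀ x {y y′} → (∀ m → y m ≈ y′ m) → ∀ k m → convolve x y k m ≈ convolve x y′ k m
  convolve-congʳ x eq k zero    = *-congˡ (eq zero)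
  convolve-congʳ x eq k (suc m) = +-cong (*-congˡ (eq (suc m))) (-‿cong (convolve-congʳ x eq (suc k) m))

  alternate-cancel : ∀ {d₁ d₂ d₃ d₄} → (∀ k → d₁ k + d₂ k - d₃ k - d₄ k ≈ 0#) →
                     ∀ k m → alternate d₁ k m + alternate d₂ k m - alternate d₃ k m - alternate d₄ k m ≈ 0#
  alternate-cancel eq k zero    = eq k
  alternate-cancel {d₁} {d₂} {d₃} {d₄} eq k (suc m) = begin
    - a₁ + - a₂ - - a₃ - - a₄ ≈⟨ solve 4 (λ a b c d → :- a :+ :- b :- :- c :- :- d := :- (a :+ b :- c :- d)) refl a₁ a₂ a₃ a₄ ⟩
    - (a₁ + a₂ - a₃ - a₄)     ≈⟨ -‿cong (alternate-cancel eq (suc k) m) ⟩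
    - 0#                      ≈⟨ -0#≈0# ⟩
    0#                        ∎
    where
    open import Algebra.Properties.Ring ring using (-0#≈0#)
    a₁ = alternate d₁ (suc k) m
    a₂ = alternate d₂ (suc k) m
    a₃ = alternate d₃ (suc k) m
    a₄ = alternate d₄ (suc k) m

  -- Iterate `unfold` until no row of length a remains; what is left over is Y (k + m + 1) 0 with a
  -- sign.
  chain-convolve : ∀ {z x Y} → Chain z x Y →
                   ∀ k m → Y k (suc m) ≈ convolve x z k m - alternate (λ j → Y j 0) (suc k) m
  chain-convolve         isChain k zero    = unfold isChain k zero
  chain-convolve {z} {x} {Y} isChain k (suc m) = begin
    Y k (suc (suc m))                   ≈⟨ unfold isChain k (suc m) ⟩
    u - Y (suc k) (suc m)               ≈⟨ +-congˡ (-‿cong (chain-convolve isChain (suc k) m)) ⟩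
    u - (v - w)                         ≈⟨ solve 3 (λ u v w → u :- (v :- w) := (u :- v) :- :- w) refl u v w ⟩
    (u - v) - - w                       ∎
    where
    u = x k * z (suc m)
    v = convolve x z (suc k) m
    w = alternate (λ j → Y j 0) (suc (suc k)) m

  -- Collect the terms with equal index of `x`: since Y p (i + 1) + Y (p + 1) i = y p · z i, the sum
  -- becomes `y p` times the expansion of `Z`, which works because both chains share `z`. The
  -- boundary term joins the end of that expansion to the one term `x j * Y p 0` without a partner.
  convolve-chain : ∀ {z x y Y Z} → Chain z y Y → Chain z x Z → ∀ p k m →
    convolve x (Y p) k (suc m) + convolve x (Y (suc p)) k m
      ≈ y p * Z k (suc m) + alternate (λ j → y p * Z j 0 - x j * Y p 0) (suc k) m
  convolve-chain {z} {x} {y} {Y} {Z} chainY chainZ p k zero = begin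
    (x k * Y p 1 - x (suc k) * Y p 0) + x k * Y (suc p) 0
      ≈⟨ +-congʳ (+-congʳ (*-congˡ (unfold chainY p 0))) ⟩
    (x k * (y p * z 0 - Y (suc p) 0) - x (suc k) * Y p 0) + x k * Y (suc p) 0
      ≈⟨ solve 7 (λ x₀ x₁ y z r r′ s → (x₀ :* (y :* z :- r′) :- x₁ :* r) :+ x₀ :* r′
                                   := y :* (x₀ :* z :- s) :+ (y :* s :- x₁ :* r))
               refl (x k) (x (suc k)) (y p) (z 0) (Y p 0) (Y (suc p) 0) (Z (suc k) 0) ⟩
    y p * (x k * z 0 - Z (suc k) 0) + (y p * Z (suc k) 0 - x (suc k) * Y p 0)
      ≈⟨ +-congʳ (*-congˡ (unfold chainZ k 0)) ⟨
    y p * Z k 1 + (y p * Z (suc k) 0 - x (suc k) * Y p 0)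
      ∎
  convolve-chain {z} {x} {y} {Y} {Z} chainY chainZ p k (suc m) = begin
    (x k * Y p (suc (suc m)) - C) + (x k * Y (suc p) (suc m) - C′)
      ≈⟨ +-congʳ (+-congʳ (*-congˡ (unfold chainY p (suc m)))) ⟩
    (x k * (y p * z (suc m) - Y (suc p) (suc m)) - C) + (x k * Y (suc p) (suc m) - C′)
      ≈⟨ solve 6 (λ x y z r C C′ → (x :* (y :* z :- r) :- C) :+ (x :* r :- C′)
                                := y :* (x :* z) :- (C :+ C′))
               refl (x k) (y p) (z (suc m)) (Y (suc p) (suc m)) C C′ ⟩
    y p * (x k * z (suc m)) - (C + C′)
      ≈⟨ +-congˡ (-‿cong (convolve-chain chainY chainZ p (suc k) m)) ⟩
    y p * (x k * z (suc m)) - (y p * Z (suc k) (suc m) + D)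
      ≈⟨ solve 4 (λ y u v d → y :* u :- (y :* v :+ d) := y :* (u :- v) :+ :- d)
               refl (y p) (x k * z (suc m)) (Z (suc k) (suc m)) D ⟩
    y p * (x k * z (suc m) - Z (suc k) (suc m)) + - D
      ≈⟨ +-congʳ (*-congˡ (unfold chainZ k (suc m))) ⟨
    y p * Z k (suc (suc m)) + - D
      ∎
    where
    C  = convolve x (Y p) (suc k) (suc m)
    C′ = convolve x (Y (suc p)) (suc k) m
    D  = alternate (λ j → y p * Z j 0 - x j * Y p 0) (suc (suc k)) m

  sumTo : ℕ → (ℕ → Carrier) → Carrier
  sumTo zero    f = 0#
  sumTo (suc N) f = f 0 + sumTo N (λ j → f (suc j))

  sumTo-cong : ∀ N {f g} → (∀ j → j ℕ.< N → f j ≈ g j) → sumTo N f ≈ sumTo N g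
  sumTo-cong zero    eq = refl
  sumTo-cong (suc N) eq = +-cong (eq 0 ℕ.z<s) (sumTo-cong N λ j j<N → eq (suc j) (ℕ.s<s j<N))

  sumTo-+ : ∀ N f g → sumTo N (λ j → f j + g j) ≈ sumTo N f + sumTo N g
  sumTo-+ zero    f g = sym (+-identityˡ 0#)
  sumTo-+ (suc N) f g = trans (+-congˡ (sumTo-+ N _ _))
    (solve 4 (λ a b c d → (a :+ b) :+ (c :+ d) := (a :+ c) :+ (b :+ d)) refl _ _ _ _)

  sumTo-snoc : ∀ N f → sumTo (suc N) f ≈ sumTo N f + f N
  sumTo-snoc zero    f = trans (+-identityʳ _) (sym (+-identityˡ _))
  sumTo-snoc (suc N) f = trans (+-congˡ (sumTo-snoc N (λ j → f (suc j)))) (sym (+-assoc _ _ _))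

  -- Only `B⁰ 0` and `A⁺ 0` occur as second pieces, so families fall into two groups within which
  -- `convolve-chain` can combine them. The last three hypotheses identify diagrams that are
  -- described from the top in `P` and from the bottom in `Q`.
  module Telescope
    (h⁰ h⁻ : ℕ → Carrier) (A⁺ A⁻ B⁰ B⁻ P⁰ P⁺ Q⁺ Q⁻ : ℕ → ℕ → Carrier)
    (B⁰-chain : Chain (B⁰ 0) h⁰ B⁰)
    (B⁻-chain : Chain (B⁰ 0) h⁻ B⁻)
    (P⁰-chain : Chain (B⁰ 0) (λ k → A⁻ k 0) P⁰)
    (P⁺-chain : Chain (B⁰ 0) (λ k → A⁺ k 0) P⁺)
    (A⁺-chain : Chain (A⁺ 0) h⁰ A⁺)
    (A⁻-chain : Chain (A⁺ 0) h⁻ A⁻)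
    (Q⁺-chain : Chain (A⁺ 0) (λ k → B⁰ k 0) Q⁺)
    (Q⁻-chain : Chain (A⁺ 0) (λ k → B⁻ k 0) Q⁻)
    (P⁰≈Q⁻ : ∀ k → P⁰ k 0 ≈ Q⁻ k 0)
    (P⁺≈Q⁺ : ∀ k → P⁺ k 0 ≈ Q⁺ k 0)
    (P⁺₀≈Q⁺₀ : ∀ m → P⁺ 0 m ≈ Q⁺ 0 m)
    where

    -- W k is the part of the alternating expansion of P⁰ 0 (m + 1) − Q⁻ 0 (m + 1) in which
    -- both convolution indices are at least k; those equal to k make up E and O.
    L₁ L₂ L₃ L₄ E O W V : ℕ → ℕ → Carrier
    L₁ k m = A⁻ k 0 * B⁰ k m - h⁻ k * P⁺ k m
    L₂ k m = h⁻ k * Q⁺ k m - A⁺ k m * B⁻ k 0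
    L₃ k m = A⁺ k 0 * B⁻ (suc k) m - h⁰ k * P⁰ (suc k) m
    L₄ k m = h⁰ k * Q⁻ (suc k) m - A⁻ (suc k) m * B⁰ k 0
    E k m = L₁ k m + L₂ k m
    O k m = L₃ k m + L₄ k m

    c₁ c₂ c₃ c₄ : ℕ → ℕ → ℕ → Carrier
    c₁ p = convolve (λ k → A⁻ k 0) (B⁰ p)
    c₂ p = convolve h⁻ (Q⁺ p)
    c₃ p = convolve h⁻ (P⁺ p)
    c₄ p = convolve (λ k → B⁻ k 0) (A⁺ p)

    V p m = c₁ p (suc p) m + c₂ p (suc p) m - c₃ p (suc p) m - c₄ p (suc p) m
    W k m = c₁ k k m + c₂ k k m - c₃ k k m - c₄ k k m

    W-zero : ∀ k → W k 0 ≈ E k 0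
    W-zero k = solve 7 (λ a b h q p b′ a′ → a :* b :+ h :* q :- h :* p :- b′ :* a′
                                        := (a :* b :- h :* p) :+ (h :* q :- a′ :* b′))
                 refl (A⁻ k 0) (B⁰ k 0) (h⁻ k) (Q⁺ k 0) (P⁺ k 0) (B⁻ k 0) (A⁺ k 0)

    W-suc : ∀ k m → W k (suc m) ≈ E k (suc m) - V k m
    W-suc k m = solve 11 (λ a b h q p b′ a′ c₁ c₂ c₃ c₄ →
                     (a :* b :- c₁) :+ (h :* q :- c₂) :- (h :* p :- c₃) :- (b′ :* a′ :- c₄)
                  := ((a :* b :- h :* p) :+ (h :* q :- a′ :* b′)) :- (c₁ :+ c₂ :- c₃ :- c₄))
                 refl (A⁻ k 0) (B⁰ k (suc m)) (h⁻ k) (Q⁺ k (suc m)) (P⁺ k (suc m)) (B⁻ k 0) (A⁺ k (suc m))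
                 (c₁ k (suc k) m) (c₂ k (suc k) m) (c₃ k (suc k) m) (c₄ k (suc k) m)

    V-zero : ∀ k → V k 0 ≈ - O k 0
    V-zero k = begin
      a * b + h * Q⁺ k 0 - h * P⁺ k 0 - b′ * a′
        ≈⟨ +-congʳ (+-congˡ (-‿cong (*-congˡ (P⁺≈Q⁺ k)))) ⟩
      a * b + h * Q⁺ k 0 - h * Q⁺ k 0 - b′ * a′
        -- The product of `h⁰ k` and `Q⁻ (suc k) 0` is inserted with both signs to create `L₃` and
        -- `L₄`; one copy is then rewritten with `P⁰`.
        ≈⟨ solve 8 (λ a b h q b′ a′ h₀ r → a :* b :+ h :* q :- h :* q :- b′ :* a′
              := :- ((a′ :* b′ :- h₀ :* r) :+ (h₀ :* r :- a :* b)))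
              refl a b h (Q⁺ k 0) b′ a′ (h⁰ k) (Q⁻ (suc k) 0) ⟩
      - ((a′ * b′ - h⁰ k * Q⁻ (suc k) 0) + L₄ k 0)
        ≈⟨ -‿cong (+-congʳ (+-congˡ (-‿cong (*-congˡ (P⁰≈Q⁻ (suc k)))))) ⟨
      - O k 0 ∎
      where
      a  = A⁻ (suc k) 0
      b  = B⁰ k 0
      h  = h⁻ (suc k)
      b′ = B⁻ (suc k) 0
      a′ = A⁺ k 0

    -- Both summands convolve from index k + 1, with inner indices k and k + 1, so `convolve-chain`
    -- merges the convolutions pairwise. The four resulting products make up `O`, and the four
    -- boundary terms cancel.
    V-suc : ∀ k m → V k (suc m) + W (suc k) m ≈ - O k (suc m)
    V-suc k m = begin
      V k (suc m) + W (suc k) m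
        ≈⟨ solve 8 (λ a b c d a′ b′ c′ d′ → (a :+ b :- c :- d) :+ (a′ :+ b′ :- c′ :- d′)
                       := ((a :+ a′) :+ (b :+ b′)) :- (c :+ c′) :- (d :+ d′)) refl
              (c₁ k (suc k) (suc m)) (c₂ k (suc k) (suc m)) (c₃ k (suc k) (suc m)) (c₄ k (suc k) (suc m))
              (c₁ (suc k) (suc k) m) (c₂ (suc k) (suc k) m) (c₃ (suc k) (suc k) m) (c₄ (suc k) (suc k) m) ⟩
      ((c₁ k (suc k) (suc m) + c₁ (suc k) (suc k) m) + (c₂ k (suc k) (suc m) + c₂ (suc k) (suc k) m))
        - (c₃ k (suc k) (suc m) + c₃ (suc k) (suc k) m) - (c₄ k (suc k) (suc m) + c₄ (suc k) (suc k) m)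
        ≈⟨ +-cong (+-cong (+-cong (convolve-chain B⁰-chain P⁰-chain k (suc k) m)
                                  (convolve-chain Q⁺-chain A⁻-chain k (suc k) m))
                          (-‿cong (convolve-chain P⁺-chain B⁻-chain k (suc k) m)))
                  (-‿cong (convolve-chain A⁺-chain Q⁻-chain k (suc k) m)) ⟩
      ((u₁ + e₁) + (u₂ + e₂)) - (u₃ + e₃) - (u₄ + e₄)
        ≈⟨ solve 8 (λ a b c d a′ b′ c′ d′ → ((a :+ a′) :+ (b :+ b′)) :- (c :+ c′) :- (d :+ d′)
                       := (a :+ b :- c :- d) :+ (a′ :+ b′ :- c′ :- d′)) refl u₁ u₂ u₃ u₄ e₁ e₂ e₃ e₄ ⟩
      (u₁ + u₂ - u₃ - u₄) + (e₁ + e₂ - e₃ - e₄)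
        ≈⟨ +-congˡ (alternate-cancel cancel (suc (suc k)) m) ⟩
      (u₁ + u₂ - u₃ - u₄) + 0#
        ≈⟨ +-identityʳ _ ⟩
      u₁ + u₂ - u₃ - u₄
        ≈⟨ solve 7 (λ h p b a a′ b′ q → h :* p :+ b :* a :- a′ :* b′ :- h :* q
                := :- ((a′ :* b′ :- h :* p) :+ (h :* q :- a :* b)))
              refl (h⁰ k) (P⁰ (suc k) (suc m)) (B⁰ k 0) (A⁻ (suc k) (suc m)) (A⁺ k 0) (B⁻ (suc k) (suc m)) (Q⁻ (suc k) (suc m)) ⟩
      - O k (suc m) ∎
      where
      u₁ = h⁰ k * P⁰ (suc k) (suc m)
      u₂ = B⁰ k 0 * A⁻ (suc k) (suc m)
      u₃ = A⁺ k 0 * B⁻ (suc k) (suc m)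
      u₄ = h⁰ k * Q⁻ (suc k) (suc m)
      d₁ d₂ d₃ d₄ : ℕ → Carrier
      d₁ j = h⁰ k * P⁰ j 0 - A⁻ j 0 * B⁰ k 0
      d₂ j = B⁰ k 0 * A⁻ j 0 - h⁻ j * Q⁺ k 0
      d₃ j = A⁺ k 0 * B⁻ j 0 - h⁻ j * P⁺ k 0
      d₄ j = h⁰ k * Q⁻ j 0 - B⁻ j 0 * A⁺ k 0
      e₁ = alternate d₁ (suc (suc k)) m
      e₂ = alternate d₂ (suc (suc k)) m
      e₃ = alternate d₃ (suc (suc k)) m
      e₄ = alternate d₄ (suc (suc k)) m
      cancel : ∀ j → d₁ j + d₂ j - d₃ j - d₄ j ≈ 0#
      cancel j = begin
        d₁ j + d₂ j - d₃ j - d₄ j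
          ≈⟨ +-congʳ (+-cong (+-congʳ (+-congʳ (*-congˡ (P⁰≈Q⁻ j)))) (-‿cong (+-congˡ (-‿cong (*-congˡ (P⁺≈Q⁺ k)))))) ⟩
        (h⁰ k * Q⁻ j 0 - A⁻ j 0 * B⁰ k 0) + d₂ j - (A⁺ k 0 * B⁻ j 0 - h⁻ j * Q⁺ k 0) - d₄ j
          ≈⟨ solve 8 (λ h q a b h′ q′ a′ b′ → (h :* q :- a :* b) :+ (b :* a :- h′ :* q′) :- (a′ :* b′ :- h′ :* q′) :- (h :* q :- b′ :* a′)
                       := h :- h) refl (h⁰ k) (Q⁻ j 0) (A⁻ j 0) (B⁰ k 0) (h⁻ j) (Q⁺ k 0) (A⁺ k 0) (B⁻ j 0) ⟩
        h⁰ k - h⁰ k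
          ≈⟨ -‿inverseʳ _ ⟩
        0# ∎

    W-one : ∀ k → W k 1 ≈ E k 1 + O k 0
    W-one k = begin
      W k 1                  ≈⟨ W-suc k 0 ⟩
      E k 1 - V k 0          ≈⟨ +-congˡ (-‿cong (V-zero k)) ⟩
      E k 1 - - O k 0        ≈⟨ solve 2 (λ a b → a :- :- b := a :+ b) refl (E k 1) (O k 0) ⟩
      E k 1 + O k 0          ∎

    -- One turn of the telescope. Passing from k to k + 1 uses up two rows, which is why the sums of
    -- the theorem stop near n/2.
    W-two : ∀ k m → W k (suc (suc m)) ≈ (E k (suc (suc m)) + O k (suc m)) + W (suc k) m
    W-two k m = begin
      W k (suc (suc m))      ≈⟨ W-suc k (suc m) ⟩
      e - V k (suc m)        ≈⟨ solve 3 (λ e v w → e :- v := e :- (v :+ w) :+ w) refl e (V k (suc m)) (W (suc k) m) ⟩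
      e - (V k (suc m) + W (suc k) m) + W (suc k) m
                             ≈⟨ +-congʳ (+-congˡ (-‿cong (V-suc k m))) ⟩
      e - - O k (suc m) + W (suc k) m
                             ≈⟨ +-congʳ (solve 2 (λ a b → a :- :- b := a :+ b) refl e (O k (suc m))) ⟩
      (e + O k (suc m)) + W (suc k) m ∎
      where e = E k (suc (suc m))

    -- The two expansions supply only `c₁` and `c₄`, which do not reproduce themselves. The missing
    -- `c₂` and `c₃` are equal at index 0 by `P⁺₀≈Q⁺₀` and can be inserted with opposite signs.
    W-start : ∀ m → P⁰ 0 (suc m) - Q⁻ 0 (suc m) ≈ W 0 m
    W-start m = begin
      P⁰ 0 (suc m) - Q⁻ 0 (suc m)
        ≈⟨ +-cong (chain-convolve P⁰-chain 0 m) (-‿cong (chain-convolve Q⁻-chain 0 m)) ⟩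
      (c₁ 0 0 m - r) - (c₄ 0 0 m - r′)
        ≈⟨ +-congʳ (+-congˡ (-‿cong (alternate-cong P⁰≈Q⁻ 1 m))) ⟩
      (c₁ 0 0 m - r′) - (c₄ 0 0 m - r′)
        ≈⟨ solve 4 (λ a b r c → (a :- r) :- (b :- r) := a :+ c :- c :- b) refl (c₁ 0 0 m) (c₄ 0 0 m) r′ (c₂ 0 0 m) ⟩
      c₁ 0 0 m + c₂ 0 0 m - c₂ 0 0 m - c₄ 0 0 m
        ≈⟨ +-congʳ (+-congˡ (-‿cong (convolve-congʳ h⁻ P⁺₀≈Q⁺₀ 0 m))) ⟨
      W 0 m ∎
      where
      r  = alternate (λ j → P⁰ j 0) 1 m
      r′ = alternate (λ j → Q⁻ j 0) 1 m
      alternate-cong : ∀ {d d′} → (∀ k → d k ≈ d′ k) → ∀ k m → alternate d k m ≈ alternate d′ k m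
      alternate-cong eq k zero    = eq k
      alternate-cong eq k (suc m) = -‿cong (alternate-cong eq (suc k) m)


    l₁ l₂ l₃ l₄ : ℕ → ℕ → Carrier
    l₁ n j = L₁ j (n ℕ.∸ 2 ℕ.* suc j)
    l₂ n j = L₂ j (n ℕ.∸ 2 ℕ.* suc j)
    l₃ n j = L₃ j (n ℕ.∸ 2 ℕ.* suc j ℕ.∸ 1)
    l₄ n j = L₄ j (n ℕ.∸ 2 ℕ.* suc j ℕ.∸ 1)

    W-sum : ∀ r N k → W k (double N ℕ.+ r) ≈
              sumTo N (λ j → E (j ℕ.+ k) (double (N ℕ.∸ j) ℕ.+ r) + O (j ℕ.+ k) (double (N ℕ.∸ j) ℕ.+ r ℕ.∸ 1)) + W (N ℕ.+ k) r
    W-sum r zero    k = sym (+-identityˡ _)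
    W-sum r (suc N) k = begin
      W k (suc (suc (double N ℕ.+ r)))      ≈⟨ W-two k (double N ℕ.+ r) ⟩
      e + W (suc k) (double N ℕ.+ r)        ≈⟨ +-congˡ (W-sum r N (suc k)) ⟩
      e + (sumTo N (λ j → E (j ℕ.+ suc k) (M j) + O (j ℕ.+ suc k) (M j ℕ.∸ 1)) + W (N ℕ.+ suc k) r)
        ≈⟨ +-assoc _ _ _ ⟨
      (e + sumTo N (λ j → E (j ℕ.+ suc k) (M j) + O (j ℕ.+ suc k) (M j ℕ.∸ 1))) + W (N ℕ.+ suc k) r
        ≈⟨ +-cong (+-congˡ (sumTo-cong N λ j _ → reflexive (≡.cong (λ i → E i (M j) + O i (M j ℕ.∸ 1)) (ℕ.+-suc j k))))
                  (reflexive (≡.cong (λ i → W i r) (ℕ.+-suc N k))) ⟩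
      (e + sumTo N (λ j → E (suc j ℕ.+ k) (M j) + O (suc j ℕ.+ k) (M j ℕ.∸ 1))) + W (suc N ℕ.+ k) r ∎
      where
      M : ℕ → ℕ
      M j = double (N ℕ.∸ j) ℕ.+ r
      e = E k (suc (suc (double N ℕ.+ r))) + O k (suc (double N ℕ.+ r))

    difference : ∀ N r {n} → n ≡ suc (suc (double N ℕ.+ r)) →
      P⁰ 0 (n ℕ.∸ 1) - Q⁻ 0 (n ℕ.∸ 1) ≈
        ((sumTo N (l₁ n) + sumTo N (l₂ n)) + (sumTo N (l₃ n) + sumTo N (l₄ n))) + W N r
    difference N r {n} ≡.refl = begin
      P⁰ 0 (suc (double N ℕ.+ r)) - Q⁻ 0 (suc (double N ℕ.+ r))
        ≈⟨ W-start (double N ℕ.+ r) ⟩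
      W 0 (double N ℕ.+ r)
        ≈⟨ W-sum r N 0 ⟩
      sumTo N (λ j → E (j ℕ.+ 0) (double (N ℕ.∸ j) ℕ.+ r) + O (j ℕ.+ 0) (double (N ℕ.∸ j) ℕ.+ r ℕ.∸ 1)) + W (N ℕ.+ 0) r
        ≈⟨ +-cong (sumTo-cong N λ j j<N → reflexive
                    (≡.cong₂ (λ i M → E i M + O i (M ℕ.∸ 1)) (ℕ.+-identityʳ j) (≡.sym (remainder N r j (ℕ.<⇒≤ j<N)))))
                  (reflexive (≡.cong (λ i → W i r) (ℕ.+-identityʳ N))) ⟩
      sumTo N (λ j → (l₁ n j + l₂ n j) + (l₃ n j + l₄ n j)) + W N r
        ≈⟨ +-congʳ (trans (sumTo-+ N _ _) (+-cong (sumTo-+ N _ _) (sumTo-+ N _ _))) ⟩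
      ((sumTo N (l₁ n) + sumTo N (l₂ n)) + (sumTo N (l₃ n) + sumTo N (l₄ n))) + W N r ∎

    snoc : ∀ N r {n} → n ≡ suc (suc (double N ℕ.+ r)) → ∀ (L : ℕ → ℕ → Carrier) (g : ℕ → ℕ) →
           sumTo N (λ j → L j (g (n ℕ.∸ 2 ℕ.* suc j))) + L N (g r) ≈ sumTo (suc N) (λ j → L j (g (n ℕ.∸ 2 ℕ.* suc j)))
    snoc N r ≡.refl L g = trans (+-congˡ (reflexive (≡.cong (λ i → L N (g i)) (≡.sym (remainder-last N r))))) (sym (sumTo-snoc N _))

    -- The leftover `W N 0` is `L₁ N 0 + L₂ N 0`. The former continues the first sum; the latter has
    -- no row of length a left above its long row and stands apart.
    difference-even : ∀ N {n} → n ≡ suc (suc (double N ℕ.+ 0)) →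
      P⁰ 0 (n ℕ.∸ 1) - Q⁻ 0 (n ℕ.∸ 1) ≈ sumTo (suc N) (l₁ n) + sumTo N (l₂ n) + sumTo N (l₃ n) + sumTo N (l₄ n) + L₂ N 0
    difference-even N {n} n≡ = begin
      P⁰ 0 (n ℕ.∸ 1) - Q⁻ 0 (n ℕ.∸ 1)                           ≈⟨ difference N 0 n≡ ⟩
      ((p₁ + p₂) + (p₃ + p₄)) + W N 0                           ≈⟨ +-congˡ (W-zero N) ⟩
      ((p₁ + p₂) + (p₃ + p₄)) + (L₁ N 0 + L₂ N 0)
        ≈⟨ solve 6 (λ a b c d e f → ((a :+ b) :+ (c :+ d)) :+ (e :+ f) := (a :+ e) :+ b :+ c :+ d :+ f)
             refl p₁ p₂ p₃ p₄ (L₁ N 0) (L₂ N 0) ⟩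
      (p₁ + L₁ N 0) + p₂ + p₃ + p₄ + L₂ N 0                     ≈⟨ +-congʳ (+-congʳ (+-congʳ (+-congʳ (snoc N 0 n≡ L₁ (λ i → i))))) ⟩
      sumTo (suc N) (l₁ n) + p₂ + p₃ + p₄ + L₂ N 0              ∎
      where
      p₁ = sumTo N (l₁ n)
      p₂ = sumTo N (l₂ n)
      p₃ = sumTo N (l₃ n)
      p₄ = sumTo N (l₄ n)

    -- The leftover `W N 1` continues the first three sums by one term each, and this time `L₄ N 0`
    -- stands apart.
    difference-odd : ∀ N {n} → n ≡ suc (suc (double N ℕ.+ 1)) →
      P⁰ 0 (n ℕ.∸ 1) - Q⁻ 0 (n ℕ.∸ 1) ≈
        sumTo (suc N) (l₁ n) + sumTo (suc N) (l₂ n) + sumTo (suc N) (l₃ n) + sumTo N (l₄ n) + L₄ N 0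
    difference-odd N {n} n≡ = begin
      P⁰ 0 (n ℕ.∸ 1) - Q⁻ 0 (n ℕ.∸ 1)                           ≈⟨ difference N 1 n≡ ⟩
      ((p₁ + p₂) + (p₃ + p₄)) + W N 1                           ≈⟨ +-congˡ (W-one N) ⟩
      ((p₁ + p₂) + (p₃ + p₄)) + ((L₁ N 1 + L₂ N 1) + (L₃ N 0 + L₄ N 0))
        ≈⟨ solve 8 (λ a b c d e f g h → ((a :+ b) :+ (c :+ d)) :+ ((e :+ f) :+ (g :+ h)) := (a :+ e) :+ (b :+ f) :+ (c :+ g) :+ d :+ h)
             refl p₁ p₂ p₃ p₄ (L₁ N 1) (L₂ N 1) (L₃ N 0) (L₄ N 0) ⟩
      (p₁ + L₁ N 1) + (p₂ + L₂ N 1) + (p₃ + L₃ N 0) + p₄ + L₄ N 0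
        ≈⟨ +-congʳ (+-congʳ (+-cong (+-cong (snoc N 1 n≡ L₁ (λ i → i)) (snoc N 1 n≡ L₂ (λ i → i))) (snoc N 1 n≡ L₃ (ℕ._∸ 1)))) ⟩
      sumTo (suc N) (l₁ n) + sumTo (suc N) (l₂ n) + sumTo (suc N) (l₃ n) + p₄ + L₄ N 0 ∎
      where
      p₁ = sumTo N (l₁ n)
      p₂ = sumTo N (l₂ n)
      p₃ = sumTo N (l₃ n)
      p₄ = sumTo N (l₄ n)

-- Exchange of row tails

length-drop-∸ : ∀ {a} {A : Set a} b (v : List A) → length (drop (length v ℕ.∸ b) v) ℕ.≤ b
length-drop-∸ b v = ℕ.≤-trans
  (ℕ.≤-reflexive (List.length-drop (length v ℕ.∸ b) v))
  (ℕ.m≤n+o⇒m∸n≤o (length v) (length v ℕ.∸ b) (ℕ.≤-trans (ℕ.m≤n+m∸n (length v) b) (ℕ.≤-reflexive (ℕ.+-comm b _))))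

-- Rows σ with overlaps σ̄ whose last entry is 1. The row below σ then meets it in a single column,
-- so σ constrains only the last letter of that row.
data Upper : List ℕ → List ℕ → Set where
  []   : Upper [] []
  end  : ∀ {s} → Upper (s ∷ []) (1 ∷ [])
  _∷_  : ∀ {s s′ S b′ S̄} b → Upper (s′ ∷ S) (b′ ∷ S̄) → Upper (s ∷ s′ ∷ S) (b ∷ b′ ∷ S̄)


-- Finite sums in a commutative ring

module ListSum {c ℓ} (R : CommutativeRing c ℓ) where
  open CommutativeRing R hiding (zero)
  open import Algebra.Properties.CommutativeSemigroup +-commutativeSemigroup using (interchange)

  module _ {a} {A : Set a} where
    ∑[_] : List A → (A → Carrier) → Carrier
    ∑[ []     ] f = 0#
    ∑[ a ∷ as ] f = f a + ∑[ as ] f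

    ∑-cong : ∀ as {f g : A → Carrier} → (∀ a → f a ≈ g a) → ∑[ as ] f ≈ ∑[ as ] g
    ∑-cong []       eq = refl
    ∑-cong (a ∷ as) eq = +-cong (eq a) (∑-cong as eq)

    ∑-0 : ∀ as → ∑[ as ] (λ _ → 0#) ≈ 0#
    ∑-0 []       = refl
    ∑-0 (a ∷ as) = trans (+-identityˡ _) (∑-0 as)

    ∑-+ : ∀ as f g → ∑[ as ] (λ a → f a + g a) ≈ ∑[ as ] f + ∑[ as ] g
    ∑-+ []       f g = sym (+-identityˡ _)
    ∑-+ (a ∷ as) f g = trans (+-congˡ (∑-+ as f g)) (interchange _ _ _ _)

    ∑-*ˡ : ∀ as x f → ∑[ as ] (λ a → x * f a) ≈ x * ∑[ as ] f
    ∑-*ˡ []       x f = sym (zeroʳ x)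
    ∑-*ˡ (a ∷ as) x f = trans (+-congˡ (∑-*ˡ as x f)) (sym (distribˡ x _ _))

    ∑-*ʳ : ∀ as x f → ∑[ as ] (λ a → f a * x) ≈ ∑[ as ] f * x
    ∑-*ʳ []       x f = sym (zeroˡ x)
    ∑-*ʳ (a ∷ as) x f = trans (+-congˡ (∑-*ʳ as x f)) (sym (distribʳ x _ _))

    ∑-++ : ∀ as bs f → ∑[ as ++ bs ] f ≈ ∑[ as ] f + ∑[ bs ] f
    ∑-++ []       bs f = sym (+-identityˡ _)
    ∑-++ (a ∷ as) bs f = trans (+-congˡ (∑-++ as bs f)) (sym (+-assoc _ _ _))

  module _ {a b} {A : Set a} {B : Set b} where
    ∑-swap : ∀ as bs (f : A → B → Carrier) → ∑[ as ] (λ a → ∑[ bs ] (f a)) ≈ ∑[ bs ] (λ b → ∑[ as ] (λ a → f a b))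
    ∑-swap []       bs f = sym (∑-0 bs)
    ∑-swap (a ∷ as) bs f = trans (+-congˡ (∑-swap as bs f)) (sym (∑-+ bs _ _))

    ∑-map : ∀ (g : A → B) as f → ∑[ map g as ] f ≈ ∑[ as ] (λ a → f (g a))
    ∑-map g []       f = refl
    ∑-map g (a ∷ as) f = +-congˡ (∑-map g as f)

    ∑-*-∑ : ∀ as bs (f : A → Carrier) (g : B → Carrier) →
            ∑[ as ] f * ∑[ bs ] g ≈ ∑[ as ] (λ a → ∑[ bs ] (λ b → f a * g b))
    ∑-*-∑ as bs f g = trans (sym (∑-*ʳ as _ f)) (∑-cong as (λ a → sym (∑-*ˡ bs (f a) g)))

  ∑-cartesianProductWith : ∀ {a b c} {A : Set a} {B : Set b} {C : Set c} (h : A → B → C) as bs f →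
    ∑[ cartesianProductWith h as bs ] f ≈ ∑[ as ] (λ a → ∑[ bs ] (λ b → f (h a b)))
  ∑-cartesianProductWith h []       bs f = refl
  ∑-cartesianProductWith h (a ∷ as) bs f =
    trans (∑-++ (map (h a) bs) _ f) (+-cong (∑-map (h a) bs f) (∑-cartesianProductWith h as bs f))

-- As in diagram, a missing overlap is read as 0.
head₀ : List ℕ → ℕ
head₀ []      = 0
head₀ (b ∷ β) = b

-- Under this condition the subtraction in placeAbove is not truncated.
Fits : List ℕ → List ℕ → Set
Fits []           β = ⊤
Fits (a ∷ [])     β = ⊤
Fits (a ∷ a′ ∷ α) β = head₀ β ℕ.≤ a′ × Fits (a′ ∷ α) (drop 1 β)

-- The overlap is added to the upper offset instead of being subtracted from the lower end, so no
-- truncation can occur. The bottom offset is free because only relative positions matter.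
data Represents : List ℕ → List ℕ → Diagram → Set where
  []  : ∀ {β} → Represents [] β []
  [-] : ∀ {a o β} → Represents (a ∷ []) β (row o a ∷ [])
  _∷_ : ∀ {a o a′ o′ α β D} → o ℕ.+ head₀ β ≡ o′ ℕ.+ a′ → Represents (a′ ∷ α) (drop 1 β) (row o′ a′ ∷ D) →
        Represents (a ∷ a′ ∷ α) β (row o a ∷ row o′ a′ ∷ D)

diagram-∷ : ∀ a α β → diagram (a ∷ α ∥ β) ≡ placeAbove a (head₀ β) (diagram (α ∥ drop 1 β))
diagram-∷ a α []      = ≡.refl
diagram-∷ a α (b ∷ β) = ≡.refl

diagram-represents : ∀ α β → Fits α β → Represents α β (diagram (α ∥ β))
diagram-represents []           β fits = []
diagram-represents (a ∷ [])     β fits = ≡.subst (Represents (a ∷ []) β) (≡.sym (diagram-∷ a [] β)) [-]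
diagram-represents (a ∷ a′ ∷ α) β (b≤a′ , fits) =
  ≡.subst (Represents (a ∷ a′ ∷ α) β) (≡.sym (diagram-∷ a (a′ ∷ α) β)) (place (diagram-represents (a′ ∷ α) (drop 1 β) fits))
  where
  place : ∀ {D} → Represents (a′ ∷ α) (drop 1 β) D → Represents (a ∷ a′ ∷ α) β (placeAbove a (head₀ β) D)
  place rep@([-] {o = o})     = ℕ.m∸n+n≡m (ℕ.≤-trans b≤a′ (ℕ.m≤n+m a′ o)) ∷ rep
  place rep@(_∷_ {o = o} _ _) = ℕ.m∸n+n≡m (ℕ.≤-trans b≤a′ (ℕ.m≤n+m a′ o)) ∷ rep

-- Column strictness depends only on the difference of the offsets; `k` is the number of boxes of
-- the lower row to the left of the overlap.
Shifted : ∀ {m n n′} → ℕ → Vec (Fin m) n → Vec (Fin m) n′ → Set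
Shifted k u v = ∀ p q → k ℕ.+ Fin.toℕ p ≡ Fin.toℕ q → lookup u p Fin.< lookup v q

-- Decided by recursion along the rows, so that its boolean factors column by column in the way
-- `columns` does.
shifted? : ∀ {m n n′} k (u : Vec (Fin m) n) (v : Vec (Fin m) n′) → Dec (Shifted k u v)
shifted? (suc k) u       []      = yes λ p ()
shifted? (suc k) u       (j ∷ v) = map′
  (λ { f p (Fin.suc q) eq → f p q (ℕ.suc-injective eq) })
  (λ f p q eq → f p (Fin.suc q) (≡.cong suc eq))
  (shifted? k u v)
shifted? zero    []      v       = yes λ ()
shifted? zero    (i ∷ u) []      = yes λ p ()
shifted? zero    (i ∷ u) (j ∷ v) = map′
  (λ { (i<j , f) Fin.zero Fin.zero eq → i<j ; (i<j , f) (Fin.suc p) (Fin.suc q) eq → f p q (ℕ.suc-injective eq) })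
  (λ f → f Fin.zero Fin.zero ≡.refl , λ p q eq → f (Fin.suc p) (Fin.suc q) (≡.cong suc eq))
  (i Fin.<? j ×-dec shifted? zero u v)

module Rows {c ℓ} (R : CommutativeRing c ℓ) {m : ℕ} (x : Fin m → CommutativeRing.Carrier R) where
  open CommutativeRing R hiding (zero)
  open IntegerCoefficients R
  open ListSum R
  open import Relation.Binary.Reasoning.Setoid setoid

  Word : Set
  Word = List (Fin m)

  ⟦_⟧ : Bool → Carrier
  ⟦ b ⟧ = if b then 1# else 0#

  one : {A : Set} → A → Carrier
  one _ = 1#

  from : Fin m → Fin m → Carrier
  from i j = ⟦ does (i Fin.≤? j) ⟧

  below : Fin m → Fin m → Carrier
  below i j = ⟦ does (i Fin.<? j) ⟧

  -- Sum over the weakly increasing words u of length n; the factor s weights the first letter.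
  rowSum : (Fin m → Carrier) → ℕ → (Word → Carrier) → Carrier
  rowSum s zero    g = g []
  rowSum s (suc n) g = ∑[ allFin m ] λ i → (s i * x i) * rowSum (from i) n (λ u → g (i ∷ u))

  rowSum-cong : ∀ s n {f g} → (∀ u → length u ≡ n → f u ≈ g u) → rowSum s n f ≈ rowSum s n g
  rowSum-cong s zero    eq = eq [] ≡.refl
  rowSum-cong s (suc n) eq =
    ∑-cong (allFin m) λ i → *-congˡ (rowSum-cong (from i) n λ u |u| → eq (i ∷ u) (≡.cong suc |u|))

  rowSum-*ˡ : ∀ s n a g → rowSum s n (λ u → a * g u) ≈ a * rowSum s n g
  rowSum-*ˡ s zero    a g = refl
  rowSum-*ˡ s (suc n) a g = trans
    (∑-cong (allFin m) λ i → trans (*-congˡ (rowSum-*ˡ (from i) n a _))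
      (solve 3 (λ a b c → b :* (a :* c) := a :* (b :* c)) refl a (s i * x i) _))
    (∑-*ˡ (allFin m) a _)

  rowSum-*ʳ : ∀ s n a g → rowSum s n (λ u → g u * a) ≈ rowSum s n g * a
  rowSum-*ʳ s n a g = trans (rowSum-cong s n λ u _ → *-comm _ _) (trans (rowSum-*ˡ s n a g) (*-comm _ _))

  rowSum-+ : ∀ s n f g → rowSum s n (λ u → f u + g u) ≈ rowSum s n f + rowSum s n g
  rowSum-+ s zero    f g = refl
  rowSum-+ s (suc n) f g = trans
    (∑-cong (allFin m) λ i → trans (*-congˡ (rowSum-+ (from i) n _ _)) (distribˡ _ _ _))
    (∑-+ (allFin m) _ _)

  rowSum-∑ : ∀ {A : Set} s n as (f : A → Word → Carrier) →
             rowSum s n (λ u → ∑[ as ] (λ a → f a u)) ≈ ∑[ as ] (λ a → rowSum s n (f a))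
  rowSum-∑ s zero    as f = refl
  rowSum-∑ s (suc n) as f = trans
    (∑-cong (allFin m) λ i → trans (*-congˡ (rowSum-∑ (from i) n as _)) (sym (∑-*ˡ as _ _)))
    (∑-swap (allFin m) as _)

  columns : Word → Word → Carrier
  columns []      v       = 1#
  columns (i ∷ u) []      = 1#
  columns (i ∷ u) (j ∷ v) = below i j * columns u v

  columns-[] : ∀ u → columns u [] ≈ 1#
  columns-[] []      = refl
  columns-[] (i ∷ u) = refl

  -- On nonempty words `Q` depends on the last letter alone. This is the effect of a row above that
  -- overlaps in one column, and the exchange leaves that letter at the end.
  LastOnly : (Word → Carrier) → Set ℓ
  LastOnly Q = ∀ i j u → Q (i ∷ j ∷ u) ≈ Q (j ∷ u)

  -- For indicators: if `s′` admits `i` and `i ≤ j`, then `s` admits `j`. Thus a letter that follows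
  -- `i` in the long row may become the first letter of the upper row without a further condition.
  Subordinate : (s s′ : Fin m → Carrier) → Set ℓ
  Subordinate s s′ = ∀ i j → i Fin.≤ j → s′ i * s j ≈ s′ i

  ⟦⟧-yes : ∀ {p} {P : Set p} (P? : Dec P) → P → ⟦ does P? ⟧ ≈ 1#
  ⟦⟧-yes P? p = reflexive (≡.cong ⟦_⟧ (dec-true P? p))

  ⟦⟧-no : ∀ {p} {P : Set p} (P? : Dec P) → ¬ P → ⟦ does P? ⟧ ≈ 0#
  ⟦⟧-no P? ¬p = reflexive (≡.cong ⟦_⟧ (dec-false P? ¬p))

  ⟦⟧-*-cong : ∀ {p} {P : Set p} (P? : Dec P) {y z} → (P → y ≈ z) → ⟦ does P? ⟧ * y ≈ ⟦ does P? ⟧ * z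
  ⟦⟧-*-cong (yes p) eq = *-congˡ (eq p)
  ⟦⟧-*-cong (no _)  eq = trans (zeroˡ _) (sym (zeroˡ _))

  from-subordinate : ∀ i j → i Fin.≤ j → Subordinate (from i) (from j)
  from-subordinate i j i≤j k l k≤l = trans
    (⟦⟧-*-cong (j Fin.≤? k) λ j≤k → ⟦⟧-yes (i Fin.≤? l) (Fin.≤-trans {i = i} {j} {l} i≤j (Fin.≤-trans {i = j} {k} {l} j≤k k≤l)))
    (*-identityʳ _)

  below+from : ∀ i j → below i j + from j i ≈ 1#
  below+from i j = case (i Fin.<? j) of λ where
    (yes i<j) → trans (+-cong (⟦⟧-yes (i Fin.<? j) i<j) (⟦⟧-no (j Fin.≤? i) (ℕ.<⇒≱ i<j))) (+-identityʳ 1#)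
    (no i≮j)  → trans (+-cong (⟦⟧-no (i Fin.<? j) i≮j) (⟦⟧-yes (j Fin.≤? i) (ℕ.≮⇒≥ i≮j))) (+-identityˡ 1#)

  from-* : ∀ s s′ → Subordinate s s′ → ∀ i j → s′ j * from j i ≈ (s i * s′ j) * from j i
  from-* s s′ sub i j = trans (*-comm _ _) (trans
    (⟦⟧-*-cong (j Fin.≤? i) λ j≤i → trans (sym (sub j i j≤i)) (*-comm _ _)) (*-comm _ _))

  below-* : ∀ i j {y z} → (i Fin.≤ j → y ≈ z) → below i j * y ≈ below i j * z
  below-* i j eq = ⟦⟧-*-cong (i Fin.<? j) λ i<j → eq (ℕ.<⇒≤ i<j)

  module _ (d : ℕ) where

    -- A pair of rows u, v whose first bad column is u_i ≥ v_i corresponds to the pair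
    -- u_1 … u_{i−1} v_{i+1} …  and  … v_i u_i u_{i+1} … .  The recursion runs over the
    -- columns before the bad one; s and s′ carry the bounds imposed by those columns.
    swap : ∀ c s s′ Q → Subordinate s s′ → LastOnly Q →
      rowSum s (suc c ℕ.+ d) (λ u → Q u * rowSum s′ (suc c) (columns u))
        + rowSum s c one * rowSum s′ (suc (suc c ℕ.+ d)) Q
      ≈ rowSum s (suc c ℕ.+ d) Q * rowSum s′ (suc c) one
    swap c s s′ Q sub last = begin
      rowSum s (suc c ℕ.+ d) (λ u → Q u * rowSum s′ (suc c) (columns u)) + rowSum s c one * rowSum s′ (suc (suc c ℕ.+ d)) Q
        ≈⟨ +-cong strict long ⟩
      ∑∑ (λ i j → w i j * (below i j * D i j))
        + (∑∑ (λ i j → w i j * (below i j * Z c i j)) + ∑∑ (λ i j → w i j * (from j i * GI i j)))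
        ≈⟨ +-assoc _ _ _ ⟨
      (∑∑ (λ i j → w i j * (below i j * D i j))
        + ∑∑ (λ i j → w i j * (below i j * Z c i j))) + ∑∑ (λ i j → w i j * (from j i * GI i j))
        ≈⟨ +-congʳ (∑∑-+ _ _) ⟨
      ∑∑ (λ i j → w i j * (below i j * D i j) + w i j * (below i j * Z c i j)) + ∑∑ (λ i j → w i j * (from j i * GI i j))
        ≈⟨ ∑∑-+ _ _ ⟨
      ∑∑ (λ i j → (w i j * (below i j * D i j) + w i j * (below i j * Z c i j)) + w i j * (from j i * GI i j))
        ≈⟨ ∑-cong L (λ i → ∑-cong L (λ j → combine i j)) ⟩
      ∑∑ (λ i j → w i j * GI i j)
        ≈⟨ ∑-cong L (λ i → ∑-cong L (λ j →
             solve 4 (λ a b g h → (a :* b) :* (g :* h) := (a :* g) :* (b :* h)) refl (s i * x i) (s′ j * x j) (G i) (I j c))) ⟩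
      ∑∑ (λ i j → ((s i * x i) * G i) * ((s′ j * x j) * I j c))
        ≈⟨ ∑-*-∑ L L _ _ ⟨
      rowSum s (suc c ℕ.+ d) Q * rowSum s′ (suc c) one ∎
      where
      L = allFin m

      ∑∑ : (Fin m → Fin m → Carrier) → Carrier
      ∑∑ f = ∑[ L ] (λ i → ∑[ L ] (f i))

      ∑∑-+ : ∀ (f g : Fin m → Fin m → Carrier) →
             ∑∑ (λ i j → f i j + g i j) ≈ ∑∑ f + ∑∑ g
      ∑∑-+ f g = trans (∑-cong L λ i → ∑-+ L (f i) (g i)) (∑-+ L _ _)

      w : Fin m → Fin m → Carrier
      w i j = (s i * x i) * (s′ j * x j)

      G : Fin m → Carrier
      G i = rowSum (from i) (c ℕ.+ d) (λ u → Q (i ∷ u))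

      I : Fin m → ℕ → Carrier
      I i n = rowSum (from i) n one

      GI D : Fin m → Fin m → Carrier
      GI i j = G i * I j c
      D i j = rowSum (from i) (c ℕ.+ d) (λ u → Q (i ∷ u) * rowSum (from j) c (columns u))

      H : Fin m → Carrier
      H j = rowSum (from j) (suc c ℕ.+ d) (λ u → Q (j ∷ u))

      -- The pairs of a short row starting with `i` and a long row starting with `j`, to be used
      -- when `i < j`. For `c = 0` the short row is empty and the bad column can only be the first,
      -- so they contribute nothing.
      Z : ℕ → Fin m → Fin m → Carrier
      Z zero    i j = 0#
      Z (suc n) i j = I i n * H j

      H≈ : ∀ j → H j ≈ ∑[ L ] (λ i → (from j i * x i) * G i)
      H≈ j = ∑-cong L λ i → *-congˡ (rowSum-cong (from i) (c ℕ.+ d) λ u _ → last j i u)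

      strict : rowSum s (suc c ℕ.+ d) (λ u → Q u * rowSum s′ (suc c) (columns u))
                 ≈ ∑∑ (λ i j → w i j * (below i j * D i j))
      strict = ∑-cong L λ i → begin
        (s i * x i) * rowSum (from i) (c ℕ.+ d) (λ u → Q (i ∷ u) * rowSum s′ (suc c) (columns (i ∷ u)))
          ≈⟨ *-congˡ (rowSum-cong (from i) (c ℕ.+ d) λ u _ → trans (sym (∑-*ˡ L _ _)) (∑-cong L λ j → trans
               (*-congˡ (*-congˡ (rowSum-*ˡ (from j) c (below i j) (columns u))))
               (solve 4 (λ q t b r → q :* (t :* (b :* r)) := (t :* b) :* (q :* r)) refl (Q (i ∷ u)) (s′ j * x j) (below i j) _))) ⟩
        (s i * x i) * rowSum (from i) (c ℕ.+ d) (λ u → ∑[ L ] (λ j → ((s′ j * x j) * below i j) * (Q (i ∷ u) * rowSum (from j) c (columns u))))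
          ≈⟨ *-congˡ (rowSum-∑ (from i) (c ℕ.+ d) L _) ⟩
        (s i * x i) * ∑[ L ] (λ j → rowSum (from i) (c ℕ.+ d) (λ u → ((s′ j * x j) * below i j) * (Q (i ∷ u) * rowSum (from j) c (columns u))))
          ≈⟨ ∑-*ˡ L _ _ ⟨
        ∑[ L ] (λ j → (s i * x i) * rowSum (from i) (c ℕ.+ d) (λ u → ((s′ j * x j) * below i j) * (Q (i ∷ u) * rowSum (from j) c (columns u))))
          ≈⟨ ∑-cong L (λ j → trans (*-congˡ (rowSum-*ˡ (from i) (c ℕ.+ d) _ _))
               (solve 4 (λ a b e r → a :* ((b :* e) :* r) := (a :* b) :* (e :* r)) refl (s i * x i) (s′ j * x j) (below i j) _)) ⟩
        ∑[ L ] (λ j → w i j * (below i j * D i j)) ∎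

      absorb : ∀ i j → s′ j * from j i ≈ (s i * s′ j) * from j i
      absorb = from-* s s′ sub

      -- The first column is bad: the second letter `i` of the long row becomes the head of the
      -- upper row, while the short row moves behind `j` into the lower row.
      diagonal : ∑[ L ] (λ j → (s′ j * x j) * (H j * I j c)) ≈ ∑∑ (λ i j → w i j * (from j i * GI i j))
      diagonal = begin
        ∑[ L ] (λ j → (s′ j * x j) * (H j * I j c))
          ≈⟨ ∑-cong L (λ j → trans (*-congˡ (*-congʳ (H≈ j))) (trans
               (solve 3 (λ a b e → a :* (b :* e) := (a :* e) :* b) refl (s′ j * x j) _ (I j c)) (sym (∑-*ˡ L _ _)))) ⟩
        ∑[ L ] (λ j → ∑[ L ] (λ i → ((s′ j * x j) * I j c) * ((from j i * x i) * G i)))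
          ≈⟨ ∑-swap L L _ ⟩
        ∑∑ (λ i j → ((s′ j * x j) * I j c) * ((from j i * x i) * G i))
          ≈⟨ ∑-cong L (λ i → ∑-cong L (λ j → trans
               (solve 6 (λ t y h f z g → ((t :* y) :* h) :* ((f :* z) :* g) := (t :* f) :* ((y :* h) :* (z :* g)))
                  refl (s′ j) (x j) (I j c) (from j i) (x i) (G i))
               (trans (*-congʳ (absorb i j))
               (solve 7 (λ s t y h f z g → ((s :* t) :* f) :* ((y :* h) :* (z :* g)) := ((s :* z) :* (t :* y)) :* (f :* (g :* h)))
                  refl (s i) (s′ j) (x j) (I j c) (from j i) (x i) (G i))))) ⟩
        ∑∑ (λ i j → w i j * (from j i * GI i j)) ∎

      long-aux : ∀ n → n ≡ c → rowSum s n one * ∑[ L ] (λ j → (s′ j * x j) * H j)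
             ≈ ∑∑ (λ i j → w i j * (below i j * Z n i j)) + ∑∑ (λ i j → w i j * (from j i * GI i j))
      long-aux zero ≡.refl = begin
        1# * ∑[ L ] (λ j → (s′ j * x j) * H j)
          ≈⟨ *-identityˡ _ ⟩
        ∑[ L ] (λ j → (s′ j * x j) * H j)
          ≈⟨ ∑-cong L (λ j → *-congˡ (*-identityʳ _)) ⟨
        ∑[ L ] (λ j → (s′ j * x j) * (H j * 1#))
          ≈⟨ diagonal ⟩
        ∑∑ (λ i j → w i j * (from j i * GI i j))
          ≈⟨ +-identityˡ _ ⟨
        0# + ∑∑ (λ i j → w i j * (from j i * GI i j))
          ≈⟨ +-congʳ (trans (∑-cong L λ i → trans (∑-cong L λ j → trans (*-congˡ (zeroʳ _)) (zeroʳ _)) (∑-0 L)) (∑-0 L)) ⟨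
        ∑∑ (λ i j → w i j * (below i j * 0#)) + ∑∑ (λ i j → w i j * (from j i * GI i j)) ∎
      long-aux (suc n) ≡.refl = begin
        ∑[ L ] (λ i → (s i * x i) * I i n) * ∑[ L ] (λ j → (s′ j * x j) * H j)
          ≈⟨ ∑-*-∑ L L _ _ ⟩
        ∑∑ (λ i j → ((s i * x i) * I i n) * ((s′ j * x j) * H j))
          ≈⟨ ∑-cong L (λ i → ∑-cong L (λ j → trans
               (solve 4 (λ a b e f → (a :* b) :* (e :* f) := (a :* e) :* (b :* f)) refl (s i * x i) (I i n) (s′ j * x j) (H j))
               (trans (*-congˡ (trans (sym (*-identityˡ _)) (trans (*-congʳ (sym (below+from i j))) (distribʳ _ _ _)))) (distribˡ _ _ _)))) ⟩
        ∑∑ (λ i j → w i j * (below i j * Z (suc n) i j) + w i j * (from j i * (I i n * H j)))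
          ≈⟨ ∑∑-+ _ _ ⟩
        ∑∑ (λ i j → w i j * (below i j * Z (suc n) i j)) + ∑∑ (λ i j → w i j * (from j i * (I i n * H j)))
          ≈⟨ +-congˡ (trans regroup diagonal) ⟩
        ∑∑ (λ i j → w i j * (below i j * Z (suc n) i j)) + ∑∑ (λ i j → w i j * (from j i * GI i j)) ∎
        where
        -- For `j ≤ i` the short row may stand behind `j` as a whole, so summing over its head `i`
        -- gives `I j (suc n)`; the bound `s i` follows from `s′ j`.
        regroup : ∑∑ (λ i j → w i j * (from j i * (I i n * H j))) ≈ ∑[ L ] (λ j → (s′ j * x j) * (H j * I j (suc n)))
        regroup = begin
          ∑∑ (λ i j → w i j * (from j i * (I i n * H j)))
            ≈⟨ ∑-cong L (λ i → ∑-cong L (λ j → trans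
                 (solve 7 (λ s t y h f z g → ((s :* z) :* (t :* y)) :* (f :* (h :* g)) := ((s :* t) :* f) :* ((y :* g) :* (z :* h)))
                    refl (s i) (s′ j) (x j) (I i n) (from j i) (x i) (H j))
                 (trans (*-congʳ (sym (absorb i j)))
                 (solve 6 (λ t y h f z g → (t :* f) :* ((y :* g) :* (z :* h)) := ((t :* y) :* g) :* ((f :* z) :* h))
                    refl (s′ j) (x j) (I i n) (from j i) (x i) (H j))))) ⟩
          ∑∑ (λ i j → ((s′ j * x j) * H j) * ((from j i * x i) * I i n))
            ≈⟨ ∑-swap L L _ ⟩
          ∑[ L ] (λ j → ∑[ L ] (λ i → ((s′ j * x j) * H j) * ((from j i * x i) * I i n)))
            ≈⟨ ∑-cong L (λ j → trans (∑-*ˡ L _ _) (*-assoc _ _ _)) ⟩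
          ∑[ L ] (λ j → (s′ j * x j) * (H j * I j (suc n))) ∎

      long : rowSum s c one * rowSum s′ (suc (suc c ℕ.+ d)) Q
             ≈ ∑∑ (λ i j → w i j * (below i j * Z c i j)) + ∑∑ (λ i j → w i j * (from j i * GI i j))
      long = long-aux c ≡.refl

      inner : ∀ n → n ≡ c → ∀ i j → i Fin.≤ j → D i j + Z n i j ≈ GI i j
      inner zero ≡.refl i j i≤j = begin
        rowSum (from i) d (λ u → Q (i ∷ u) * columns u []) + 0#
          ≈⟨ +-identityʳ _ ⟩
        rowSum (from i) d (λ u → Q (i ∷ u) * columns u [])
          ≈⟨ rowSum-cong (from i) d (λ u _ → trans (*-congˡ (columns-[] u)) (*-identityʳ _)) ⟩
        G i
          ≈⟨ *-identityʳ _ ⟨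
        G i * 1# ∎
      inner (suc n) ≡.refl i j i≤j = trans
        (+-congˡ (*-congˡ (∑-cong L λ k → *-congˡ (rowSum-cong (from k) (suc n ℕ.+ d) λ u _ → trans (last j k u) (sym (last i k u))))))
        -- A good column `i < j` is removed; it bounds the remaining upper letters by `i` and the
        -- lower ones by `j`, and prepending `i` to nonempty words does not change `Q`.
        (swap n (from i) (from j) (λ u → Q (i ∷ u)) (from-subordinate i j i≤j) (λ k l u → trans (last i k (l ∷ u)) (trans (last k l u) (sym (last i l u)))))

      combine : ∀ i j → (w i j * (below i j * D i j) + w i j * (below i j * Z c i j)) + w i j * (from j i * GI i j) ≈ w i j * GI i j
      combine i j = begin
        (w i j * (below i j * D i j) + w i j * (below i j * Z c i j)) + w i j * (from j i * GI i j)
          ≈⟨ solve 6 (λ w b d z f g → (w :* (b :* d) :+ w :* (b :* z)) :+ w :* (f :* g) := w :* (b :* (d :+ z) :+ f :* g))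
               refl (w i j) (below i j) (D i j) (Z c i j) (from j i) (GI i j) ⟩
        w i j * (below i j * (D i j + Z c i j) + from j i * GI i j)
          ≈⟨ *-congˡ (+-congʳ (below-* i j (inner c ≡.refl i j))) ⟩
        w i j * (below i j * GI i j + from j i * GI i j)
          ≈⟨ *-congˡ (distribʳ _ _ _) ⟨
        w i j * ((below i j + from j i) * GI i j)
          ≈⟨ *-congˡ (trans (*-congʳ (below+from i j)) (*-identityˡ _)) ⟩
        w i j * GI i j ∎

  Prefix : ℕ → (Word → Carrier) → Set ℓ
  Prefix n k = ∀ p u v → length p ≡ n → k (p ++ u) ≈ k (p ++ v)

  -- The `e` lower letters left of the overlap are the same in both configurations and can be summed
  -- outside one by one. At `e = 0` the exchange still fixes the first lower letter, the only one
  -- `k` sees, so `k` can be absorbed into the weight `s′`.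
  swap-prefixed : ∀ c d e s Q k → LastOnly Q → Prefix (suc e) k →
    rowSum one (suc c ℕ.+ d) (λ u → Q u * rowSum s (e ℕ.+ suc c) (λ v → columns u (drop e v) * k v))
      + rowSum one c one * rowSum s (e ℕ.+ suc (suc c ℕ.+ d)) (λ z → Q z * k z)
    ≈ rowSum one (suc c ℕ.+ d) Q * rowSum s (e ℕ.+ suc c) k
  swap-prefixed c d zero s Q k last prefix = begin
    rowSum one n (λ u → Q u * rowSum s (suc c) (λ v → columns u v * k v)) + rowSum one c one * rowSum s (suc n) (λ z → Q z * k z)
      ≈⟨ +-cong (rowSum-cong one n λ u _ → *-congˡ {x = Q u} (absorb c (columns u))) (*-congˡ (absorb n Q)) ⟩
    rowSum one n (λ u → Q u * rowSum s′ (suc c) (columns u)) + rowSum one c one * rowSum s′ (suc n) Q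
      ≈⟨ swap d c one s′ Q (λ i j _ → *-identityʳ _) last ⟩
    rowSum one n Q * rowSum s′ (suc c) one
      ≈⟨ *-congˡ (absorb c one) ⟨
    rowSum one n Q * rowSum s (suc c) (λ v → 1# * k v)
      ≈⟨ *-congˡ (rowSum-cong s (suc c) λ v _ → *-identityˡ (k v)) ⟩
    rowSum one n Q * rowSum s (suc c) k ∎
    where
    n = suc c ℕ.+ d
    s′ : Fin m → Carrier
    s′ j = s j * k (j ∷ [])
    absorb : ∀ l g → rowSum s (suc l) (λ v → g v * k v) ≈ rowSum s′ (suc l) g
    absorb l g = ∑-cong (allFin m) λ j → begin
      (s j * x j) * rowSum (from j) l (λ v → g (j ∷ v) * k (j ∷ v))
        ≈⟨ *-congˡ (rowSum-cong (from j) l λ v _ → *-congˡ (prefix (j ∷ []) v [] ≡.refl)) ⟩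
      (s j * x j) * rowSum (from j) l (λ v → g (j ∷ v) * k (j ∷ []))
        ≈⟨ *-congˡ (rowSum-*ʳ (from j) l _ _) ⟩
      (s j * x j) * (rowSum (from j) l (λ v → g (j ∷ v)) * k (j ∷ []))
        ≈⟨ solve 4 (λ s x r k → (s :* x) :* (r :* k) := ((s :* k) :* x) :* r) refl (s j) (x j) _ _ ⟩
      (s′ j * x j) * rowSum (from j) l (λ v → g (j ∷ v)) ∎
  swap-prefixed c d (suc e) s Q k last prefix = begin
    rowSum one n (λ u → Q u * ∑[ L ] (λ j → (s j * x j) * r u j)) + h * ∑[ L ] (λ j → (s j * x j) * z j)
      ≈⟨ +-cong left (trans (sym (∑-*ˡ L _ _)) (∑-cong L λ j → trans
           (solve 3 (λ h a z → h :* (a :* z) := a :* (h :* z)) refl h (s j * x j) (z j)) (*-congˡ (*-congˡ (right j))))) ⟩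
    ∑[ L ] (λ j → (s j * x j) * rowSum one n (λ u → Q u * r u j)) + ∑[ L ] (λ j → (s j * x j) * (h * z′ j))
      ≈⟨ ∑-+ L _ _ ⟨
    ∑[ L ] (λ j → (s j * x j) * rowSum one n (λ u → Q u * r u j) + (s j * x j) * (h * z′ j))
      ≈⟨ ∑-cong L (λ j → trans (sym (distribˡ _ _ _)) (trans
           (*-congˡ (swap-prefixed c d e (from j) Q (λ v → k (j ∷ v)) last (λ p u v |p| → prefix (j ∷ p) u v (≡.cong suc |p|))))
           (solve 3 (λ a q b → a :* (q :* b) := q :* (a :* b)) refl (s j * x j) (rowSum one n Q) _))) ⟩
    ∑[ L ] (λ j → rowSum one n Q * ((s j * x j) * rowSum (from j) (e ℕ.+ suc c) (λ v → k (j ∷ v))))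
      ≈⟨ ∑-*ˡ L _ _ ⟩
    rowSum one n Q * rowSum s (suc e ℕ.+ suc c) k ∎
    where
    L = allFin m
    n = suc c ℕ.+ d
    h = rowSum one c one
    r : Word → Fin m → Carrier
    r u j = rowSum (from j) (e ℕ.+ suc c) (λ v → columns u (drop e v) * k (j ∷ v))
    z z′ : Fin m → Carrier
    z  j = rowSum (from j) (e ℕ.+ suc n) (λ v → Q (j ∷ v) * k (j ∷ v))
    z′ j = rowSum (from j) (e ℕ.+ suc n) (λ v → Q v * k (j ∷ v))
    left : rowSum one n (λ u → Q u * ∑[ L ] (λ j → (s j * x j) * r u j)) ≈ ∑[ L ] (λ j → (s j * x j) * rowSum one n (λ u → Q u * r u j))
    left = begin
      rowSum one n (λ u → Q u * ∑[ L ] (λ j → (s j * x j) * r u j))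
        ≈⟨ rowSum-cong one n (λ u _ → trans (sym (∑-*ˡ L _ _)) (∑-cong L λ j →
             solve 3 (λ q a r → q :* (a :* r) := a :* (q :* r)) refl (Q u) (s j * x j) (r u j))) ⟩
      rowSum one n (λ u → ∑[ L ] (λ j → (s j * x j) * (Q u * r u j)))
        ≈⟨ rowSum-∑ one n L (λ j u → (s j * x j) * (Q u * r u j)) ⟩
      ∑[ L ] (λ j → rowSum one n (λ u → (s j * x j) * (Q u * r u j)))
        ≈⟨ ∑-cong L (λ j → rowSum-*ˡ one n (s j * x j) (λ u → Q u * r u j)) ⟩
      ∑[ L ] (λ j → (s j * x j) * rowSum one n (λ u → Q u * r u j)) ∎
    last′ : ∀ j v l → length v ≡ e ℕ.+ suc l → Q (j ∷ v) ≈ Q v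
    last′ j []      l |v| = contradiction (≡.trans |v| (ℕ.+-suc e l)) λ ()
    last′ j (i ∷ v) l |v| = last j i v
    right : ∀ j → z j ≈ z′ j
    right j = rowSum-cong (from j) (e ℕ.+ suc n) λ v |v| → *-congʳ (last′ j v n |v|)

  -- The row u, of length at least b, lies on top of v and overlaps it in b columns.
  attach : ℕ → Word → Word → Carrier
  attach b u v = columns u (drop (length v ℕ.∸ b) v)

  -- Generating function of the tableaux of shape (α ∥ β) in the letters of Fin m,
  -- whose top row u is weighted by Q u.
  tableaux : (Word → Carrier) → List ℕ → List ℕ → Carrier
  tableaux Q []      β = 1#
  tableaux Q (a ∷ α) β = rowSum one a (λ u → Q u * tableaux (attach (head₀ β) u) α (drop 1 β))

  tableaux-cong : ∀ {Q Q′} → (∀ u → Q u ≈ Q′ u) → ∀ α β → tableaux Q α β ≈ tableaux Q′ α β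
  tableaux-cong eq []      β = refl
  tableaux-cong eq (a ∷ α) β = rowSum-cong one a λ u _ → *-congʳ (eq u)

  columns-prefix : ∀ p u v → length v ℕ.≤ length p → columns (p ++ u) v ≈ columns p v
  columns-prefix []      u []      _         = columns-[] u
  columns-prefix (i ∷ p) u []      _         = refl
  columns-prefix (i ∷ p) u (j ∷ v) (s≤s v≤p) = *-congˡ (columns-prefix p u v v≤p)

  attach-prefix : ∀ {b} p u v → b ℕ.≤ length p → attach b (p ++ u) v ≈ attach b p v
  attach-prefix {b} p u v b≤p = columns-prefix p u _ (ℕ.≤-trans (length-drop-∸ b v) b≤p)

  lower-prefix : ∀ n V V̄ → head₀ V̄ ℕ.≤ n → Prefix n (λ v → tableaux (attach (head₀ V̄) v) V (drop 1 V̄))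
  lower-prefix n V V̄ b≤n p u v |p| = tableaux-cong (λ t → trans (attach-prefix p u t b≤p) (sym (attach-prefix p v t b≤p))) V (drop 1 V̄)
    where
    b≤p : head₀ V̄ ℕ.≤ length p
    b≤p = ≡.subst (head₀ V̄ ℕ.≤_) (≡.sym |p|) b≤n

  -- A condition is imposed only if the weighted top row itself takes part in the exchange;
  -- otherwise the upper row of the pair is weighted by the row above it.
  Start : List ℕ → (Word → Carrier) → Set ℓ
  Start []      Q = LastOnly Q
  Start (_ ∷ _) Q = Lift ℓ ⊤

  -- The overlap has `suc c` columns, `d` upper boxes lie to its right and `e` lower boxes to its
  -- left. The bound on `head₀ V̄` confines the influence of the lower rows to the letters that stay
  -- in place.
  exchange : ∀ c d e {V V̄ S S̄} → Upper S S̄ → ∀ Q → Start S Q → head₀ V̄ ℕ.≤ suc e →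
    tableaux Q (S ++ suc c ℕ.+ d ∷ e ℕ.+ suc c ∷ V) (S̄ ++ suc c ∷ V̄)
      + rowSum one c one * tableaux Q (S ++ e ℕ.+ suc (suc c ℕ.+ d) ∷ V) (S̄ ++ V̄)
    ≈ tableaux Q (S ++ List.[ suc c ℕ.+ d ]) S̄ * tableaux one (e ℕ.+ suc c ∷ V) V̄
  exchange c d e {V} {V̄} [] Q last b≤1+e = begin
    rowSum one n (λ u → Q u * rowSum one (e ℕ.+ suc c) (λ v → attach (suc c) u v * k v)) + rowSum one c one * rowSum one (e ℕ.+ suc n) (λ z → Q z * k z)
      ≈⟨ +-congʳ (rowSum-cong one n λ u _ → *-congˡ {x = Q u} (rowSum-cong one (e ℕ.+ suc c) λ v |v| →
           *-congʳ {x = k v} (reflexive (≡.cong (λ l → columns u (drop l v)) (≡.trans (≡.cong (ℕ._∸ suc c) |v|) (ℕ.m+n∸n≡m e (suc c))))))) ⟩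
    rowSum one n (λ u → Q u * rowSum one (e ℕ.+ suc c) (λ v → columns u (drop e v) * k v)) + rowSum one c one * rowSum one (e ℕ.+ suc n) (λ z → Q z * k z)
      ≈⟨ swap-prefixed c d e one Q k last (lower-prefix (suc e) V V̄ b≤1+e) ⟩
    rowSum one n Q * rowSum one (e ℕ.+ suc c) k
      ≈⟨ *-cong (rowSum-cong one n λ u _ → *-identityʳ (Q u)) (rowSum-cong one (e ℕ.+ suc c) λ v _ → *-identityˡ _) ⟨
    rowSum one n (λ u → Q u * 1#) * rowSum one (e ℕ.+ suc c) (λ v → 1# * k v) ∎
    where
    n = suc c ℕ.+ d
    k : Word → Carrier
    k v = tableaux (attach (head₀ V̄) v) V (drop 1 V̄)
  exchange c d e {V} {V̄} {s ∷ S} {b ∷ S̄} upper Q _ b≤1+e = begin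
    rowSum one s (λ u → Q u * t₁ u) + h * rowSum one s (λ u → Q u * t₂ u)
      ≈⟨ +-congˡ (rowSum-*ˡ one s h _) ⟨
    rowSum one s (λ u → Q u * t₁ u) + rowSum one s (λ u → h * (Q u * t₂ u))
      ≈⟨ rowSum-+ one s _ _ ⟨
    rowSum one s (λ u → Q u * t₁ u + h * (Q u * t₂ u))
      ≈⟨ rowSum-cong one s (λ u _ → trans
           (solve 4 (λ q a h b → q :* a :+ h :* (q :* b) := q :* (a :+ h :* b)) refl (Q u) (t₁ u) h (t₂ u))
           (trans (*-congˡ (step upper u)) (sym (*-assoc _ _ _)))) ⟩
    rowSum one s (λ u → (Q u * tableaux (attach b u) (S ++ List.[ suc c ℕ.+ d ]) S̄) * tableaux one (e ℕ.+ suc c ∷ V) V̄)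
      ≈⟨ rowSum-*ʳ one s _ _ ⟩
    rowSum one s (λ u → Q u * tableaux (attach b u) (S ++ List.[ suc c ℕ.+ d ]) S̄) * tableaux one (e ℕ.+ suc c ∷ V) V̄ ∎
    where
    h = rowSum one c one
    t₁ t₂ : Word → Carrier
    t₁ u = tableaux (attach b u) (S ++ suc c ℕ.+ d ∷ e ℕ.+ suc c ∷ V) (S̄ ++ suc c ∷ V̄)
    t₂ u = tableaux (attach b u) (S ++ e ℕ.+ suc (suc c ℕ.+ d) ∷ V) (S̄ ++ V̄)
    step : Upper (s ∷ S) (b ∷ S̄) → ∀ u → t₁ u + h * t₂ u ≈ tableaux (attach b u) (S ++ List.[ suc c ℕ.+ d ]) S̄ * tableaux one (e ℕ.+ suc c ∷ V) V̄
    -- The overlap 1 required by `Upper` makes `attach 1 u` a function of the last letter.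
    step end          u = exchange c d e {V} {V̄} [] (attach 1 u) (λ i j v → refl) b≤1+e
    step (_ ∷ upper′)  u = exchange c d e {V} {V̄} upper′ (attach b u) (lift tt) b≤1+e

  -- From enumerated fillings to row sums

  ⟦∧⟧ : ∀ b b′ → ⟦ b ∧ b′ ⟧ ≈ ⟦ b ⟧ * ⟦ b′ ⟧
  ⟦∧⟧ true  b′ = sym (*-identityˡ _)
  ⟦∧⟧ false b′ = sym (zeroˡ _)

  weight : Word → Carrier
  weight []      = 1#
  weight (i ∷ u) = x i * weight u

  weight-++ : ∀ u v → weight (u ++ v) ≈ weight u * weight v
  weight-++ []      v = sym (*-identityˡ _)
  weight-++ (i ∷ u) v = trans (*-congˡ (weight-++ u v)) (sym (*-assoc _ _ _))

  shifted?-columns : ∀ {n n′} k (u : Vec (Fin m) n) (v : Vec (Fin m) n′) →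
                     ⟦ does (shifted? k u v) ⟧ ≈ columns (toList u) (drop k (toList v))
  shifted?-columns (suc k) u       []      = sym (columns-[] (toList u))
  shifted?-columns (suc k) u       (j ∷ v) = shifted?-columns k u v
  shifted?-columns zero    []      v       = refl
  shifted?-columns zero    (i ∷ u) []      = refl
  shifted?-columns zero    (i ∷ u) (j ∷ v) = trans (⟦∧⟧ (does (i Fin.<? j)) _) (*-congˡ (shifted?-columns zero u v))

  -- Equal columns o + p = o′ + q mean q = (a′ - b) + p. Decisions of equivalent statements have the
  -- same boolean, so the search over all positions may be replaced by `shifted?`.
  columnStrict-attach : ∀ {a o a′ o′ b} (u : Vec (Fin m) a) (v : Vec (Fin m) a′) → b ℕ.≤ a′ → o ℕ.+ b ≡ o′ ℕ.+ a′ →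
                        (P? : Dec (ColumnStrict (row o a) (row o′ a′) u v)) → ⟦ does P? ⟧ ≈ attach b (toList u) (toList v)
  columnStrict-attach {a} {o} {a′} {o′} {b} u v b≤a′ eq P? = begin
    ⟦ does P? ⟧                                         ≡⟨ ≡.cong ⟦_⟧ (does-⇔ (mk⇔ to from′) P? (shifted? (a′ ℕ.∸ b) u v)) ⟩
    ⟦ does (shifted? (a′ ℕ.∸ b) u v) ⟧                  ≈⟨ shifted?-columns (a′ ℕ.∸ b) u v ⟩
    columns (toList u) (drop (a′ ℕ.∸ b) (toList v))     ≡⟨ ≡.cong (λ l → columns (toList u) (drop (l ℕ.∸ b) (toList v))) (Vec.length-toList v) ⟨
    attach b (toList u) (toList v)                      ∎
    where
    o≡ : o ≡ o′ ℕ.+ (a′ ℕ.∸ b)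
    o≡ = ≡.trans (≡.sym (ℕ.m+n∸n≡m o b)) (≡.trans (≡.cong (ℕ._∸ b) eq) (ℕ.+-∸-assoc o′ b≤a′))
    shift : ∀ p → o ℕ.+ p ≡ o′ ℕ.+ (a′ ℕ.∸ b ℕ.+ p)
    shift p = ≡.trans (≡.cong (ℕ._+ p) o≡) (ℕ.+-assoc o′ _ p)
    to : ColumnStrict (row o a) (row o′ a′) u v → Shifted (a′ ℕ.∸ b) u v
    to f p q e = f p q (≡.trans (shift (Fin.toℕ p)) (≡.cong (o′ ℕ.+_) e))
    from′ : Shifted (a′ ℕ.∸ b) u v → ColumnStrict (row o a) (row o′ a′) u v
    from′ f p q e = f p q (ℕ.+-cancelˡ-≡ o′ _ _ (≡.trans (≡.sym (shift (Fin.toℕ p))) e))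

  linkedSum : ∀ i n g →
    ∑[ words m n ] (λ u → (⟦ does (linked? Fin._≤?_ (i ∷ u)) ⟧ * weight (toList u)) * g (toList u)) ≈ rowSum (from i) n g
  linkedSum i zero    g = trans (+-identityʳ _) (trans (*-congʳ (*-identityˡ _)) (*-identityˡ _))
  linkedSum i (suc n) g = trans (∑-cartesianProductWith _∷_ (allFin m) (words m n) _) (∑-cong (allFin m) λ j → begin
    ∑[ words m n ] (λ u → (⟦ does (i Fin.≤? j) ∧ l j u ⟧ * (x j * weight (toList u))) * g (j ∷ toList u))
      ≈⟨ ∑-cong (words m n) (λ u → trans (*-congʳ (*-congʳ (⟦∧⟧ (does (i Fin.≤? j)) (l j u))))
           (solve 5 (λ a b x w g → ((a :* b) :* (x :* w)) :* g := (a :* x) :* ((b :* w) :* g)) refl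
              (from i j) ⟦ l j u ⟧ (x j) (weight (toList u)) (g (j ∷ toList u)))) ⟩
    ∑[ words m n ] (λ u → (from i j * x j) * ((⟦ l j u ⟧ * weight (toList u)) * g (j ∷ toList u)))
      ≈⟨ ∑-*ˡ (words m n) _ _ ⟩
    (from i j * x j) * ∑[ words m n ] (λ u → (⟦ l j u ⟧ * weight (toList u)) * g (j ∷ toList u))
      ≈⟨ *-congˡ (linkedSum j n (λ u → g (j ∷ u))) ⟩
    (from i j * x j) * rowSum (from j) n (λ u → g (j ∷ u)) ∎)
    where
    l : Fin m → Vec (Fin m) n → Bool
    l j u = does (linked? Fin._≤?_ (j ∷ u))

  wordsSum : ∀ n g → ∑[ words m n ] (λ u → (⟦ does (linked? Fin._≤?_ u) ⟧ * weight (toList u)) * g (toList u)) ≈ rowSum one n g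
  wordsSum zero    g = trans (+-identityʳ _) (trans (*-congʳ (*-identityˡ _)) (*-identityˡ _))
  wordsSum (suc n) g = trans (∑-cartesianProductWith _∷_ (allFin m) (words m n) _) (∑-cong (allFin m) λ j → begin
    ∑[ words m n ] (λ u → (⟦ does (linked? Fin._≤?_ (j ∷ u)) ⟧ * (x j * weight (toList u))) * g (j ∷ toList u))
      ≈⟨ ∑-cong (words m n) (λ u → solve 4 (λ b x w g → (b :* (x :* w)) :* g := x :* ((b :* w) :* g)) refl _ (x j) (weight (toList u)) (g (j ∷ toList u))) ⟩
    ∑[ words m n ] (λ u → x j * ((⟦ does (linked? Fin._≤?_ (j ∷ u)) ⟧ * weight (toList u)) * g (j ∷ toList u)))
      ≈⟨ ∑-*ˡ (words m n) _ _ ⟩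
    x j * ∑[ words m n ] (λ u → (⟦ does (linked? Fin._≤?_ (j ∷ u)) ⟧ * weight (toList u)) * g (j ∷ toList u))
      ≈⟨ *-cong (sym (*-identityˡ _)) (linkedSum j n (λ u → g (j ∷ u))) ⟩
    (1# * x j) * rowSum (from j) n (λ u → g (j ∷ u)) ∎)

  topRow : ∀ D → Filling m D → Word
  topRow []      []      = []
  topRow (r ∷ D) (u ∷ T) = toList u

  fillingSum : (Word → Carrier) → Diagram → Carrier
  fillingSum Q D = ∑[ fillings m D ] λ T → Q (topRow D T) * (⟦ does (semiStandard? D T) ⟧ * weight (entries D T))

  fillingSum-tableaux : ∀ {a α β D} Q → Fits (a ∷ α) β → Represents (a ∷ α) β D → fillingSum Q D ≈ tableaux Q (a ∷ α) β
  fillingSum-tableaux {a} Q _ [-] = begin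
    fillingSum Q (row _ a ∷ [])
      ≈⟨ ∑-cartesianProductWith _∷_ (words m a) _ _ ⟩
    ∑[ words m a ] (λ u → Q (toList u) * (⟦ does (linked? Fin._≤?_ u) ⟧ * weight (toList u ++ [])) + 0#)
      ≈⟨ ∑-cong (words m a) (λ u → trans (+-identityʳ _) (trans
           (*-congˡ (*-congˡ (reflexive (≡.cong weight (List.++-identityʳ (toList u))))))
           (trans (*-comm _ _) (*-congˡ (sym (*-identityʳ _)))))) ⟩
    ∑[ words m a ] (λ u → (⟦ does (linked? Fin._≤?_ u) ⟧ * weight (toList u)) * (Q (toList u) * 1#))
      ≈⟨ wordsSum a (λ u → Q u * 1#) ⟩
    rowSum one a (λ u → Q u * 1#) ∎
  fillingSum-tableaux {a} {a′ ∷ α} {β} Q (b≤a′ , fits) (_∷_ {o = o} {o′ = o′} {D = D} eq rep) = begin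
    fillingSum Q (r ∷ r′ ∷ D)
      ≈⟨ ∑-cartesianProductWith _∷_ (words m a) _ _ ⟩
    ∑[ words m a ] (λ u → ∑[ fillings m (r′ ∷ D) ] (λ T → Q (toList u) * (⟦ does (semiStandard? (r ∷ r′ ∷ D) (u ∷ T)) ⟧ * weight (toList u ++ entries (r′ ∷ D) T))))
      ≈⟨ ∑-cong (words m a) (λ u → trans (∑-cong (fillings m (r′ ∷ D)) (split u)) (∑-*ˡ (fillings m (r′ ∷ D)) _ _)) ⟩
    ∑[ words m a ] (λ u → ((⟦ does (linked? Fin._≤?_ u) ⟧ * weight (toList u)) * Q (toList u)) * fillingSum (attach (head₀ β) (toList u)) (r′ ∷ D))
      ≈⟨ ∑-cong (words m a) (λ u → trans (*-assoc _ _ _) (*-congˡ (*-congˡ (fillingSum-tableaux (attach (head₀ β) (toList u)) fits rep)))) ⟩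
    ∑[ words m a ] (λ u → (⟦ does (linked? Fin._≤?_ u) ⟧ * weight (toList u)) * (Q (toList u) * tableaux (attach (head₀ β) (toList u)) (a′ ∷ α) (drop 1 β)))
      ≈⟨ wordsSum a (λ u → Q u * tableaux (attach (head₀ β) u) (a′ ∷ α) (drop 1 β)) ⟩
    tableaux Q (a ∷ a′ ∷ α) β ∎
    where
    r = row o a
    r′ = row o′ a′
    split : ∀ u T → Q (toList u) * (⟦ does (semiStandard? (r ∷ r′ ∷ D) (u ∷ T)) ⟧ * weight (toList u ++ entries (r′ ∷ D) T))
              ≈ ((⟦ does (linked? Fin._≤?_ u) ⟧ * weight (toList u)) * Q (toList u))
                * (attach (head₀ β) (toList u) (topRow (r′ ∷ D) T) * (⟦ does (semiStandard? (r′ ∷ D) T) ⟧ * weight (entries (r′ ∷ D) T)))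
    split u (v ∷ T) = trans
      (*-congˡ (*-cong (trans (⟦∧⟧ (does (linked? Fin._≤?_ u)) _) (*-congˡ (trans (⟦∧⟧ (does strict?) (does (semiStandard? (r′ ∷ D) (v ∷ T))))
        (*-congʳ (columnStrict-attach u v b≤a′ eq strict?))))) (weight-++ (toList u) (entries (r′ ∷ D) (v ∷ T)))))
      (solve 6 (λ q l c s w w′ → q :* ((l :* (c :* s)) :* (w :* w′)) := ((l :* w) :* q) :* (c :* (s :* w′))) refl (Q (toList u)) _ _ _ _ _)
      where
      strict? : Dec (ColumnStrict r r′ u v)
      strict? = Fin.all? (λ p → Fin.all? (λ q → (o ℕ.+ Fin.toℕ p ℕ.≟ o′ ℕ.+ Fin.toℕ q) →-dec (lookup u p Fin.<? lookup v q)))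

  fillingSum-diagram : ∀ α β → Fits α β → fillingSum one (diagram (α ∥ β)) ≈ tableaux one α β
  fillingSum-diagram []      β fits = trans (+-identityʳ _) (trans (*-identityˡ _) (*-identityˡ _))
  fillingSum-diagram (a ∷ α) β fits = fillingSum-tableaux one fits (diagram-represents (a ∷ α) β fits)

-- Ribbons with long rows

upper-∷ʳ : ∀ {S S̄} s → Upper S S̄ → Upper (S ++ [ s ]) (S̄ ++ [ 1 ])
upper-∷ʳ s []      = end
upper-∷ʳ s end     = 1 ∷ end
upper-∷ʳ s (b ∷ u) = b ∷ upper-∷ʳ s u

head₀-replicate : ∀ m T̄ → head₀ T̄ ℕ.≤ 1 → head₀ (replicate m 1 ++ T̄) ℕ.≤ 1
head₀-replicate zero    T̄ T̄≤1 = T̄≤1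
head₀-replicate (suc m) T̄ T̄≤1 = ℕ.≤-refl

replicate-∷ : ∀ m (a : ℕ) W → replicate m a ++ a ∷ W ≡ a ∷ replicate m a ++ W
replicate-∷ zero    a W = ≡.refl
replicate-∷ (suc m) a W = ≡.cong (a ∷_) (replicate-∷ m a W)

-- Row length n at position m of a ribbon whose first row (position 0) is one box longer.
bump : ℕ → ℕ → ℕ
bump zero    n = suc n
bump (suc m) n = n

bump-+ : ∀ m a n → bump m (a ℕ.+ n) ≡ bump m a ℕ.+ n
bump-+ zero    a n = ≡.refl
bump-+ (suc m) a n = ≡.refl

bump≥ : ∀ m n → n ℕ.≤ bump m n
bump≥ zero    n = ℕ.n≤1+n n
bump≥ (suc m) n = ℕ.≤-refl

module _ (S : List ℕ) (a : ℕ) where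
  -- Grows at the bottom because `A` and `Q` are cut there, whereas `B` and `P` are cut at the top.
  extend : ℕ → List ℕ
  extend zero    = S
  extend (suc m) = extend m ++ [ bump m a ]

  extend-++ : ∀ m W → extend (suc m) ++ W ≡ S ++ suc a ∷ replicate m a ++ W
  extend-++ zero    W = List.++-assoc S [ suc a ] W
  extend-++ (suc m) W = begin
    (extend (suc m) ++ [ a ]) ++ W          ≡⟨ List.++-assoc (extend (suc m)) [ a ] W ⟩
    extend (suc m) ++ a ∷ W                 ≡⟨ extend-++ m (a ∷ W) ⟩
    S ++ suc a ∷ replicate m a ++ a ∷ W     ≡⟨ ≡.cong (λ V → S ++ suc a ∷ V) (replicate-∷ m a W) ⟩
    S ++ suc a ∷ a ∷ replicate m a ++ W     ∎
    where open ≡.≡-Reasoning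

module _ (S̄ : List ℕ) where
  extendOverlaps : ℕ → List ℕ
  extendOverlaps zero    = S̄
  extendOverlaps (suc m) = extendOverlaps m ++ [ 1 ]

  extendOverlaps-++ : ∀ m W → extendOverlaps m ++ W ≡ S̄ ++ replicate m 1 ++ W
  extendOverlaps-++ zero    W = ≡.refl
  extendOverlaps-++ (suc m) W = begin
    (extendOverlaps m ++ [ 1 ]) ++ W     ≡⟨ List.++-assoc (extendOverlaps m) [ 1 ] W ⟩
    extendOverlaps m ++ 1 ∷ W            ≡⟨ extendOverlaps-++ m (1 ∷ W) ⟩
    S̄ ++ replicate m 1 ++ 1 ∷ W          ≡⟨ ≡.cong (S̄ ++_) (replicate-∷ m 1 W) ⟩
    S̄ ++ 1 ∷ replicate m 1 ++ W          ∎
    where open ≡.≡-Reasoning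

extend-upper : ∀ {S S̄} a → Upper S S̄ → ∀ m → Upper (extend S a m) (extendOverlaps S̄ m)
extend-upper a u zero    = u
extend-upper a u (suc m) = upper-∷ʳ (bump m a) (extend-upper a u m)

module Ribbons {c ℓ} (R : CommutativeRing c ℓ) {m : ℕ} (x : Fin m → CommutativeRing.Carrier R) where
  open CommutativeRing R hiding (zero)
  open IntegerCoefficients R
  open Alternating R
  open Rows R x
  open import Relation.Binary.Reasoning.Setoid setoid

  F : List ℕ → List ℕ → Carrier
  F = tableaux one

  h : ℕ → Carrier
  h n = F [ n ] []

  exchangeF : ∀ {S S̄ V V̄} → Upper S S̄ → ∀ c d e {x y N} → suc c ℕ.+ d ≡ x → e ℕ.+ suc c ≡ y → e ℕ.+ suc x ≡ N →
    head₀ V̄ ℕ.≤ suc e →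
    F (S ++ x ∷ y ∷ V) (S̄ ++ suc c ∷ V̄) ≈ F (S ++ [ x ]) S̄ * F (y ∷ V) V̄ - h c * F (S ++ N ∷ V) (S̄ ++ V̄)
  exchangeF {S} {S̄} {V} {V̄} u c d e ≡.refl ≡.refl ≡.refl V̄≤ = begin
    f                     ≈⟨ solve 3 (λ f h g → f := (f :+ h :* g) :- h :* g) refl f (rowSum one c one) g ⟩
    (f + rowSum one c one * g) - rowSum one c one * g
      ≈⟨ +-cong (exchange c d e {V} {V̄} u one (initial S) V̄≤) (-‿cong (*-congʳ (rowSum-cong one c λ _ _ → sym (*-identityˡ 1#)))) ⟩
    F (S ++ [ suc c ℕ.+ d ]) S̄ * F (e ℕ.+ suc c ∷ V) V̄ - h c * g ∎
    where
    f = F (S ++ suc c ℕ.+ d ∷ e ℕ.+ suc c ∷ V) (S̄ ++ suc c ∷ V̄)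
    g = F (S ++ e ℕ.+ suc (suc c ℕ.+ d) ∷ V) (S̄ ++ V̄)
    initial : ∀ S → Start S one
    initial []      _ _ _ = refl
    initial (_ ∷ _)       = lift tt

  -- The case of one common column, where the factor `h 0` is 1: a product of two pieces is the sum
  -- over the two ways to join them, in one column or within one row.
  concatenate : ∀ {S S̄ V V̄} → Upper S S̄ → ∀ {x y N} → 1 ℕ.≤ x → 1 ℕ.≤ y → x ℕ.+ y ≡ N → head₀ V̄ ℕ.≤ y →
    F (S ++ x ∷ y ∷ V) (S̄ ++ 1 ∷ V̄) ≈ F (S ++ [ x ]) S̄ * F (y ∷ V) V̄ - F (S ++ N ∷ V) (S̄ ++ V̄)
  concatenate {S} {S̄} {V} {V̄} u {suc x} {suc y} {N} _ _ eq V̄≤y = begin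
    F (S ++ suc x ∷ suc y ∷ V) (S̄ ++ 1 ∷ V̄)
      ≈⟨ exchangeF u 0 x y ≡.refl (ℕ.+-comm y 1) (≡.trans (ℕ.+-suc y (suc x)) (≡.trans (ℕ.+-comm (suc y) (suc x)) eq)) V̄≤y ⟩
    F (S ++ [ suc x ]) S̄ * F (suc y ∷ V) V̄ - (1# * 1#) * F (S ++ N ∷ V) (S̄ ++ V̄)
      ≈⟨ +-congˡ (-‿cong (trans (*-congʳ (*-identityˡ 1#)) (*-identityˡ _))) ⟩
    F (S ++ [ suc x ]) S̄ * F (suc y ∷ V) V̄ - F (S ++ N ∷ V) (S̄ ++ V̄) ∎

  -- Add and subtract `h c` times the product of the piece ending in `x` and the piece starting with
  -- `τ`. Together with it, each of the two products given by the exchange becomes a single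
  -- application of `concatenate`.
  mergeBelow : ∀ {U Ū τ τ̄ T T̄} → Upper U Ū → τ̄ ≡ 1 → 1 ℕ.≤ τ → head₀ T̄ ℕ.≤ τ →
    ∀ {c x} → 1 ℕ.≤ c → suc c ℕ.≤ x →
    F (U ++ x ∷ c ℕ.+ τ ∷ T) (Ū ++ suc c ∷ T̄)
      ≈ h c * F (U ++ x ∷ τ ∷ T) (Ū ++ τ̄ ∷ T̄) - F (U ++ [ x ]) Ū * F (c ∷ τ ∷ T) (τ̄ ∷ T̄)
  mergeBelow {U} {Ū} {suc e} {_} {T} {T̄} u ≡.refl 1≤τ T̄≤τ {c} {x} 1≤c c<x = begin
    F (U ++ x ∷ c ℕ.+ suc e ∷ T) (Ū ++ suc c ∷ T̄)
      ≈⟨ exchangeF u c (x ℕ.∸ suc c) e (ℕ.m+[n∸m]≡n c<x) (≡.trans (ℕ.+-suc e c) (ℕ.+-comm (suc e) c)) (≡.trans (ℕ.+-suc e x) (ℕ.+-comm (suc e) x)) T̄≤τ ⟩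
    A * B - h c * R′
      ≈⟨ solve 5 (λ a b h r t → a :* b :- h :* r := h :* (a :* t :- r) :- a :* (h :* t :- b)) refl A B (h c) R′ (F (suc e ∷ T) T̄) ⟩
    h c * (A * F (suc e ∷ T) T̄ - R′) - A * (h c * F (suc e ∷ T) T̄ - B)
      ≈⟨ +-cong (*-congˡ (concatenate u (ℕ.≤-trans (s≤s z≤n) c<x) 1≤τ ≡.refl T̄≤τ))
                (-‿cong (*-congˡ (concatenate {V = T} {T̄} [] 1≤c 1≤τ ≡.refl T̄≤τ))) ⟨
    h c * F (U ++ x ∷ suc e ∷ T) (Ū ++ 1 ∷ T̄) - A * F (c ∷ suc e ∷ T) (1 ∷ T̄) ∎
    where
    A = F (U ++ [ x ]) Ū
    B = F (c ℕ.+ suc e ∷ T) T̄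
    R′ = F (U ++ x ℕ.+ suc e ∷ T) (Ū ++ T̄)

  module Families {S S̄ T T̄ : List ℕ} (upper : Upper S S̄) (T̄≤1 : head₀ T̄ ℕ.≤ 1) (b : ℕ) where
    a : ℕ
    a = suc (suc b)

    -- With `a` in the form `suc (suc b)`, `v⁰ k` is `suc (v⁻ k)` by computation. Hence
    -- `bump 0 (v⁻ k)` is `v⁰ k`, and the families `P⁰` and `Q⁻` agree by `refl` at m = 0.
    v⁰ v⁻ : ℕ → ℕ
    v⁰ k = suc k ℕ.* a
    v⁻ k = suc k ℕ.* a ℕ.∸ 1

    U Ū : ℕ → List ℕ
    U = extend S a
    Ū = extendOverlaps S̄

    h⁰ h⁻ : ℕ → Carrier
    h⁰ k = h (v⁰ k)
    h⁻ k = h (v⁻ k)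

    -- Besides one row of length about (k + 1) a there are m rows of length a: above it in
    -- A and Q, below it in B and P.  A is attached to σ, B to τ, P and Q to both.
    A⁺ A⁻ B⁰ B⁻ P⁰ P⁺ Q⁺ Q⁻ : ℕ → ℕ → Carrier
    A⁺ k m = F (U m ++ [ bump m (v⁰ k) ]) (Ū m)
    A⁻ k m = F (U m ++ [ bump m (v⁻ k) ]) (Ū m)
    B⁰ k m = F (v⁰ k ∷ replicate m a ++ T) (replicate m 1 ++ T̄)
    B⁻ k m = F (v⁻ k ∷ replicate m a ++ T) (replicate m 1 ++ T̄)
    P⁰ k m = F (S ++ v⁰ k ∷ replicate m a ++ T) (S̄ ++ replicate m 1 ++ T̄)
    P⁺ k m = F (S ++ suc (v⁰ k) ∷ replicate m a ++ T) (S̄ ++ replicate m 1 ++ T̄)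
    Q⁺ k m = F (U m ++ bump m (v⁰ k) ∷ T) (Ū m ++ T̄)
    Q⁻ k m = F (U m ++ bump m (v⁻ k) ∷ T) (Ū m ++ T̄)

    v⁰0 : v⁰ 0 ≡ a
    v⁰0 = ℕ.+-identityʳ a

    v⁰+a : ∀ k → v⁰ k ℕ.+ a ≡ v⁰ (suc k)
    v⁰+a k = ℕ.+-comm (v⁰ k) a

    a+v⁻ : ∀ k → a ℕ.+ v⁻ k ≡ v⁻ (suc k)
    a+v⁻ k = ≡.cong suc (≡.sym (ℕ.+-suc b (v⁻ k)))

    v⁻+a : ∀ k → v⁻ k ℕ.+ a ≡ v⁻ (suc k)
    v⁻+a k = ≡.trans (ℕ.+-comm (v⁻ k) a) (a+v⁻ k)

    leftChain : ∀ {S S̄} → Upper S S̄ → ∀ {x N} m → 1 ℕ.≤ x → x ℕ.+ a ≡ N →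
      F (S ++ x ∷ replicate (suc m) a ++ T) (S̄ ++ replicate (suc m) 1 ++ T̄)
        ≈ F (S ++ [ x ]) S̄ * B⁰ 0 m - F (S ++ N ∷ replicate m a ++ T) (S̄ ++ replicate m 1 ++ T̄)
    leftChain u m 1≤x eq = trans
      (concatenate u 1≤x (s≤s z≤n) eq (ℕ.≤-trans (head₀-replicate m T̄ T̄≤1) (s≤s z≤n)))
      (+-congʳ (*-congˡ (reflexive (≡.cong (λ y → F (y ∷ replicate m a ++ T) (replicate m 1 ++ T̄)) (≡.sym v⁰0)))))

    -- Cut above the row `y`. If the row it merges with is the one directly below σ, the merged row
    -- inherits the extra box of that row; `bump` keeps this case in the common form of a chain.
    rightChain : ∀ m {y N V V̄} → 1 ℕ.≤ y → a ℕ.+ y ≡ N → head₀ V̄ ℕ.≤ 1 →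
      F (U (suc m) ++ y ∷ V) (Ū (suc m) ++ V̄) ≈ A⁺ 0 m * F (y ∷ V) V̄ - F (U m ++ bump m N ∷ V) (Ū m ++ V̄)
    rightChain m {y} {N} {V} {V̄} 1≤y eq V̄≤1 = begin
      F ((U m ++ [ bump m a ]) ++ y ∷ V) ((Ū m ++ [ 1 ]) ++ V̄)
        ≡⟨ ≡.cong₂ F (List.++-assoc (U m) _ _) (List.++-assoc (Ū m) _ _) ⟩
      F (U m ++ bump m a ∷ y ∷ V) (Ū m ++ 1 ∷ V̄)
        ≈⟨ concatenate (extend-upper a upper m) (ℕ.≤-trans (s≤s z≤n) (bump≥ m a)) 1≤y
             (≡.trans (≡.sym (bump-+ m a y)) (≡.cong (bump m) eq)) (ℕ.≤-trans V̄≤1 1≤y) ⟩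
      F (U m ++ [ bump m a ]) (Ū m) * F (y ∷ V) V̄ - F (U m ++ bump m N ∷ V) (Ū m ++ V̄)
        ≈⟨ +-congʳ (*-congʳ (reflexive (≡.cong (λ y → F (U m ++ [ bump m y ]) (Ū m)) (≡.sym v⁰0)))) ⟩
      A⁺ 0 m * F (y ∷ V) V̄ - F (U m ++ bump m N ∷ V) (Ū m ++ V̄) ∎

    rightChain[] : ∀ m {y N} → 1 ℕ.≤ y → a ℕ.+ y ≡ N →
      F (U (suc m) ++ [ y ]) (Ū (suc m)) ≈ h y * A⁺ 0 m - F (U m ++ [ bump m N ]) (Ū m)
    rightChain[] m {y} {N} 1≤y eq = begin
      F (U (suc m) ++ [ y ]) (Ū (suc m))
        ≡⟨ ≡.cong (F (U (suc m) ++ [ y ])) (List.++-identityʳ (Ū (suc m))) ⟨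
      F (U (suc m) ++ [ y ]) (Ū (suc m) ++ [])
        ≈⟨ rightChain m 1≤y eq z≤n ⟩
      A⁺ 0 m * h y - F (U m ++ [ bump m N ]) (Ū m ++ [])
        ≈⟨ +-cong (*-comm _ _) (-‿cong (reflexive (≡.cong (F (U m ++ [ bump m N ])) (List.++-identityʳ (Ū m))))) ⟩
      h y * A⁺ 0 m - F (U m ++ [ bump m N ]) (Ū m) ∎

    -- Both are the shape with rows a + 1, a, ..., a between σ and τ: the long row of `P` is the
    -- topmost of them, that of `Q` the bottommost.
    P⁺₀≈Q⁺₀ : ∀ m → P⁺ 0 m ≈ Q⁺ 0 m
    P⁺₀≈Q⁺₀ m = reflexive (≡.cong₂ F (shape m) (≡.sym (extendOverlaps-++ S̄ m T̄)))
      where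
      shape : ∀ m → S ++ suc (v⁰ 0) ∷ replicate m a ++ T ≡ U m ++ bump m (v⁰ 0) ∷ T
      shape zero    = ≡.refl
      shape (suc m) = ≡.trans
        (≡.cong₂ (λ y V → S ++ suc y ∷ V) v⁰0 (≡.trans (≡.sym (replicate-∷ m a T)) (≡.cong (λ y → replicate m a ++ y ∷ T) (≡.sym v⁰0))))
        (≡.sym (extend-++ S a m (v⁰ 0 ∷ T)))

    open Telescope h⁰ h⁻ A⁺ A⁻ B⁰ B⁻ P⁰ P⁺ Q⁺ Q⁻
      (chain λ k m → leftChain [] {v⁰ k} m (s≤s z≤n) (v⁰+a k))
      (chain λ k m → leftChain [] {v⁻ k} m (s≤s z≤n) (v⁻+a k))
      (chain λ k m → leftChain upper m (s≤s z≤n) (v⁰+a k))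
      (chain λ k m → leftChain upper m (s≤s z≤n) (≡.cong suc (v⁰+a k)))
      (chain λ k m → rightChain[] m (s≤s z≤n) ≡.refl)
      (chain λ k m → rightChain[] m (s≤s z≤n) (a+v⁻ k))
      (chain λ k m → trans (rightChain m (s≤s z≤n) ≡.refl T̄≤1) (+-congʳ (*-comm _ _)))
      (chain λ k m → trans (rightChain m (s≤s z≤n) (a+v⁻ k) T̄≤1) (+-congʳ (*-comm _ _)))
      (λ k → refl) (λ k → refl) P⁺₀≈Q⁺₀ public

    -- Two equal rows overlap completely, so no boxes protrude and the merged row has length v⁰ k +
    -- 1, as in `P⁺`.
    L₁-shape : ∀ k m → F (S ++ v⁰ k ∷ v⁰ k ∷ replicate m a ++ T) (S̄ ++ v⁰ k ∷ replicate m 1 ++ T̄) ≈ L₁ k m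
    L₁-shape k m = exchangeF upper (v⁻ k) 0 0 (ℕ.+-identityʳ _) ≡.refl ≡.refl (head₀-replicate m T̄ T̄≤1)

    -- The lower row protrudes by b = a - 2 boxes to the left, and the merged row has length v⁰ (k +
    -- 1).
    L₃-shape : ∀ k m → F (S ++ suc (v⁰ k) ∷ v⁻ (suc k) ∷ replicate m a ++ T) (S̄ ++ suc (v⁰ k) ∷ replicate m 1 ++ T̄) ≈ L₃ k m
    L₃-shape k m = exchangeF upper (v⁰ k) 0 b (ℕ.+-identityʳ _) (ℕ.+-suc b (v⁰ k))
      (≡.trans (ℕ.+-suc b (suc (v⁰ k))) (≡.cong suc (ℕ.+-suc b (v⁰ k)))) (ℕ.≤-trans (head₀-replicate m T̄ T̄≤1) (s≤s z≤n))

  module WithLower {S S̄ T T̄ : List ℕ} {τ τ̄ : ℕ} (upper : Upper S S̄)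
                   (τ̄≡1 : τ̄ ≡ 1) (1≤τ : 1 ℕ.≤ τ) (T̄≤τ : head₀ T̄ ℕ.≤ τ) (b : ℕ) where
    open Families {T = τ ∷ T} {τ̄ ∷ T̄} upper (ℕ.≤-reflexive τ̄≡1) b

    -- The last line of the theorem is the case m = 0 of L₂ or L₄.
    L₂-shape : ∀ k m → F (U m ++ bump m (v⁰ k) ∷ v⁻ k ℕ.+ τ ∷ T) (Ū m ++ v⁰ k ∷ T̄) ≈ L₂ k m
    L₂-shape k m = mergeBelow (extend-upper a upper m) τ̄≡1 1≤τ T̄≤τ (s≤s z≤n) (bump≥ m (v⁰ k))

    L₄-shape : ∀ k m → F (U m ++ bump m (v⁻ (suc k)) ∷ v⁰ k ℕ.+ τ ∷ T) (Ū m ++ suc (v⁰ k) ∷ T̄) ≈ L₄ k m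
    L₄-shape k m = mergeBelow (extend-upper a upper m) τ̄≡1 1≤τ T̄≤τ (s≤s z≤n)
      (ℕ.≤-trans (s≤s (ℕ.m≤n+m (v⁰ k) b)) (bump≥ m (v⁻ (suc k))))

  module WithoutLower {S S̄ : List ℕ} (upper : Upper S S̄) (b : ℕ) where
    open Families {T = []} {[]} upper z≤n b

    private
      -- Without τ, `Q` coincides with `A` and `B` at m = 0 is a single row, so `L₂` and `L₄` are
      -- commutators. This is why their lines are omitted for t = 0.
      vanish : ∀ y α m → h y * F α (Ū m ++ []) - F α (Ū m) * h y ≈ 0#
      vanish y α m = begin
        h y * F α (Ū m ++ []) - F α (Ū m) * h y  ≡⟨ ≡.cong (λ β → h y * F α β - F α (Ū m) * h y) (List.++-identityʳ (Ū m)) ⟩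
        h y * F α (Ū m) - F α (Ū m) * h y        ≈⟨ +-congʳ (*-comm _ _) ⟩
        F α (Ū m) * h y - F α (Ū m) * h y        ≈⟨ -‿inverseʳ _ ⟩
        0#                                       ∎

    L₂-zero : ∀ k m → L₂ k m ≈ 0#
    L₂-zero k m = vanish (v⁻ k) (U m ++ [ bump m (v⁰ k) ]) m

    L₄-zero : ∀ k m → L₄ k m ≈ 0#
    L₄-zero k m = vanish (v⁰ k) (U m ++ [ bump m (v⁻ (suc k)) ]) m

open ≡ using (refl)

-- Coefficients

module MonoidRing (m : ℕ) where
  open ListSum ℤ.+-*-commutativeRing
  open IntegerCoefficients ℤ.+-*-commutativeRing
  open ≡.≡-Reasoning

  Exponent : Set
  Exponent = Vec ℕ m

  infixl 6 _∙_
  _∙_ : Exponent → Exponent → Exponent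
  _∙_ = Vec.zipWith ℕ._+_

  Polynomial : Set
  Polynomial = List (ℤ × Exponent)

  term : (Exponent → ℤ) → ℤ × Exponent → ℤ
  term f (c , e) = c ℤ.* f e

  -- The linear extension of f; polynomials are compared by all such functionals.
  ⟨_,_⟩ : (Exponent → ℤ) → Polynomial → ℤ
  ⟨ f , X ⟩ = ∑[ X ] (term f)

  infix 4 _≋_
  -- The lists may repeat exponents or contain zero coefficients, and testing against all
  -- functionals replaces a normal form. Reading off a coefficient is one of these tests.
  record _≋_ (X Y : Polynomial) : Set where
    constructor equal
    field pair : ∀ f → ⟨ f , X ⟩ ≡ ⟨ f , Y ⟩
  open _≋_ public

  negate : ℤ × Exponent → ℤ × Exponent
  negate (c , e) = ℤ.- c , e

  multiply : ℤ × Exponent → ℤ × Exponent → ℤ × Exponent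
  multiply (c , e) (c′ , e′) = c ℤ.* c′ , e ∙ e′

  0ₚ 1ₚ : Polynomial
  0ₚ = []
  1ₚ = (ℤ.1ℤ , Vec.replicate m 0) ∷ []

  infixl 6 _+ₚ_
  infixl 7 _*ₚ_
  _+ₚ_ _*ₚ_ : Polynomial → Polynomial → Polynomial
  _+ₚ_ = _++_
  _*ₚ_ = cartesianProductWith multiply

  -ₚ_ : Polynomial → Polynomial
  -ₚ_ = map negate

  pair-+ : ∀ f X Y → ⟨ f , X +ₚ Y ⟩ ≡ ⟨ f , X ⟩ ℤ.+ ⟨ f , Y ⟩
  pair-+ f X Y = ∑-++ X Y (term f)

  pair-neg : ∀ f X → ⟨ f , -ₚ X ⟩ ≡ ℤ.- ⟨ f , X ⟩
  pair-neg f X = begin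
    ⟨ f , -ₚ X ⟩                          ≡⟨ ∑-map negate X (term f) ⟩
    ∑[ X ] (λ t → term f (negate t))      ≡⟨ ∑-cong X (λ (c , e) → solve 2 (λ c y → (:- c) :* y := (:- con ℤ.1ℤ) :* (c :* y)) refl c (f e)) ⟩
    ∑[ X ] (λ t → ℤ.-1ℤ ℤ.* term f t)     ≡⟨ ∑-*ˡ X ℤ.-1ℤ (term f) ⟩
    ℤ.-1ℤ ℤ.* ⟨ f , X ⟩                   ≡⟨ ℤ.-1*i≡-i ⟨ f , X ⟩ ⟩
    ℤ.- ⟨ f , X ⟩                         ∎

  -- Turns a product into iterated pairing, which reduces the multiplicative ring laws to laws of
  -- exponents and to an interchange of sums.
  pair-* : ∀ f X Y → ⟨ f , X *ₚ Y ⟩ ≡ ⟨ (λ e → ⟨ (λ e′ → f (e ∙ e′)) , Y ⟩) , X ⟩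
  pair-* f X Y = ≡.trans (∑-cartesianProductWith multiply X Y (term f))
    (∑-cong X λ (c , e) → ≡.trans (∑-cong Y λ (c′ , e′) → ℤ.*-assoc c c′ (f (e ∙ e′))) (∑-*ˡ Y c _))

  pair-cong : ∀ {f g} X → (∀ e → f e ≡ g e) → ⟨ f , X ⟩ ≡ ⟨ g , X ⟩
  pair-cong X eq = ∑-cong X λ (c , e) → ≡.cong (c ℤ.*_) (eq e)

  pair-swap : ∀ (g : Exponent → Exponent → ℤ) X Y →
              ⟨ (λ e → ⟨ (λ e′ → g e e′) , Y ⟩) , X ⟩ ≡ ⟨ (λ e′ → ⟨ (λ e → g e e′) , X ⟩) , Y ⟩
  pair-swap g X Y = begin
    ∑[ X ] (λ (c , e) → c ℤ.* ⟨ g e , Y ⟩)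
      ≡⟨ ∑-cong X (λ (c , e) → ∑-*ˡ Y c (term (g e))) ⟨
    ∑[ X ] (λ (c , e) → ∑[ Y ] (λ (c′ , e′) → c ℤ.* (c′ ℤ.* g e e′)))
      ≡⟨ ∑-swap X Y _ ⟩
    ∑[ Y ] (λ (c′ , e′) → ∑[ X ] (λ (c , e) → c ℤ.* (c′ ℤ.* g e e′)))
      ≡⟨ ∑-cong Y (λ (c′ , e′) → ≡.trans (∑-cong X (λ (c , e) → solve 3 (λ a b y → a :* (b :* y) := b :* (a :* y)) refl c c′ (g e e′)))
           (∑-*ˡ X c′ _)) ⟩
    ∑[ Y ] (λ (c′ , e′) → c′ ℤ.* ⟨ (λ e → g e e′) , X ⟩) ∎

  *ₚ-comm : ∀ X Y → X *ₚ Y ≋ Y *ₚ X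
  *ₚ-comm X Y .pair f = begin
    ⟨ f , X *ₚ Y ⟩                                 ≡⟨ pair-* f X Y ⟩
    ⟨ (λ e → ⟨ (λ e′ → f (e ∙ e′)) , Y ⟩) , X ⟩    ≡⟨ pair-swap (λ e e′ → f (e ∙ e′)) X Y ⟩
    ⟨ (λ e′ → ⟨ (λ e → f (e ∙ e′)) , X ⟩) , Y ⟩    ≡⟨ pair-cong Y (λ e′ → pair-cong X λ e → ≡.cong f (Vec.zipWith-comm ℕ.+-comm e e′)) ⟩
    ⟨ (λ e′ → ⟨ (λ e → f (e′ ∙ e)) , X ⟩) , Y ⟩    ≡⟨ pair-* f Y X ⟨
    ⟨ f , Y *ₚ X ⟩                                 ∎

  *ₚ-cong : ∀ {X X′ Y Y′} → X ≋ X′ → Y ≋ Y′ → X *ₚ Y ≋ X′ *ₚ Y′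
  *ₚ-cong {X} {X′} {Y} {Y′} X≋ Y≋ .pair f = begin
    ⟨ f , X *ₚ Y ⟩                                  ≡⟨ pair-* f X Y ⟩
    ⟨ (λ e → ⟨ (λ e′ → f (e ∙ e′)) , Y ⟩) , X ⟩     ≡⟨ pair-cong X (λ e → Y≋ .pair _) ⟩
    ⟨ (λ e → ⟨ (λ e′ → f (e ∙ e′)) , Y′ ⟩) , X ⟩    ≡⟨ X≋ .pair _ ⟩
    ⟨ (λ e → ⟨ (λ e′ → f (e ∙ e′)) , Y′ ⟩) , X′ ⟩   ≡⟨ pair-* f X′ Y′ ⟨
    ⟨ f , X′ *ₚ Y′ ⟩                                ∎

  *ₚ-assoc : ∀ X Y Z → (X *ₚ Y) *ₚ Z ≋ X *ₚ (Y *ₚ Z)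
  *ₚ-assoc X Y Z .pair f = begin
    ⟨ f , (X *ₚ Y) *ₚ Z ⟩
      ≡⟨ pair-* f (X *ₚ Y) Z ⟩
    ⟨ (λ e → ⟨ (λ e″ → f (e ∙ e″)) , Z ⟩) , X *ₚ Y ⟩
      ≡⟨ pair-* _ X Y ⟩
    ⟨ (λ e → ⟨ (λ e′ → ⟨ (λ e″ → f (e ∙ e′ ∙ e″)) , Z ⟩) , Y ⟩) , X ⟩
      ≡⟨ pair-cong X (λ e → pair-cong Y λ e′ → pair-cong Z λ e″ → ≡.cong f (Vec.zipWith-assoc ℕ.+-assoc e e′ e″)) ⟩
    ⟨ (λ e → ⟨ (λ e′ → ⟨ (λ e″ → f (e ∙ (e′ ∙ e″))) , Z ⟩) , Y ⟩) , X ⟩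
      ≡⟨ pair-cong X (λ e → pair-* _ Y Z) ⟨
    ⟨ (λ e → ⟨ (λ e′ → f (e ∙ e′)) , Y *ₚ Z ⟩) , X ⟩
      ≡⟨ pair-* f X (Y *ₚ Z) ⟨
    ⟨ f , X *ₚ (Y *ₚ Z) ⟩ ∎

  *ₚ-identityˡ : ∀ X → 1ₚ *ₚ X ≋ X
  *ₚ-identityˡ X .pair f = begin
    ⟨ f , 1ₚ *ₚ X ⟩                                             ≡⟨ pair-* f 1ₚ X ⟩
    ℤ.1ℤ ℤ.* ⟨ (λ e → f (Vec.replicate m 0 ∙ e)) , X ⟩ ℤ.+ ℤ.0ℤ ≡⟨ ≡.trans (ℤ.+-identityʳ _) (ℤ.*-identityˡ _) ⟩
    ⟨ (λ e → f (Vec.replicate m 0 ∙ e)) , X ⟩                   ≡⟨ pair-cong X (λ e → ≡.cong f (Vec.zipWith-identityˡ ℕ.+-identityˡ e)) ⟩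
    ⟨ f , X ⟩                                                   ∎

  distribʳ : ∀ X Y Z → (Y +ₚ Z) *ₚ X ≋ Y *ₚ X +ₚ Z *ₚ X
  distribʳ X Y Z .pair f = begin
    ⟨ f , (Y +ₚ Z) *ₚ X ⟩                 ≡⟨ pair-* f (Y +ₚ Z) X ⟩
    ⟨ F , Y +ₚ Z ⟩                        ≡⟨ pair-+ F Y Z ⟩
    ⟨ F , Y ⟩ ℤ.+ ⟨ F , Z ⟩               ≡⟨ ≡.cong₂ ℤ._+_ (pair-* f Y X) (pair-* f Z X) ⟨
    ⟨ f , Y *ₚ X ⟩ ℤ.+ ⟨ f , Z *ₚ X ⟩     ≡⟨ pair-+ f (Y *ₚ X) (Z *ₚ X) ⟨
    ⟨ f , Y *ₚ X +ₚ Z *ₚ X ⟩              ∎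
    where
    F : Exponent → ℤ
    F e = ⟨ (λ e′ → f (e ∙ e′)) , X ⟩

  ≋-trans : ∀ {X Y Z} → X ≋ Y → Y ≋ Z → X ≋ Z
  ≋-trans p q .pair f = ≡.trans (p .pair f) (q .pair f)

  +ₚ-cong : ∀ {X X′ Y Y′} → X ≋ X′ → Y ≋ Y′ → X +ₚ Y ≋ X′ +ₚ Y′
  +ₚ-cong {X} {X′} {Y} {Y′} X≋ Y≋ .pair f =
    ≡.trans (pair-+ f X Y) (≡.trans (≡.cong₂ ℤ._+_ (X≋ .pair f) (Y≋ .pair f)) (≡.sym (pair-+ f X′ Y′)))

  +ₚ-comm : ∀ X Y → X +ₚ Y ≋ Y +ₚ X
  +ₚ-comm X Y .pair f =
    ≡.trans (pair-+ f X Y) (≡.trans (ℤ.+-comm ⟨ f , X ⟩ ⟨ f , Y ⟩) (≡.sym (pair-+ f Y X)))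

  -ₚ-inverseʳ : ∀ X → X +ₚ -ₚ X ≋ 0ₚ
  -ₚ-inverseʳ X .pair f = ≡.trans (pair-+ f X (-ₚ X)) (≡.trans (≡.cong (λ i → ⟨ f , X ⟩ ℤ.+ i) (pair-neg f X)) (ℤ.+-inverseʳ ⟨ f , X ⟩))

  -ₚ-cong : ∀ {X Y} → X ≋ Y → -ₚ X ≋ -ₚ Y
  -ₚ-cong {X} {Y} X≋Y .pair f = ≡.trans (pair-neg f X) (≡.trans (≡.cong ℤ.-_ (X≋Y .pair f)) (≡.sym (pair-neg f Y)))

  monoidRing : CommutativeRing _ _
  monoidRing = record
    { Carrier = Polynomial
    ; _≈_ = _≋_
    ; _+_ = _+ₚ_
    ; _*_ = _*ₚ_
    ; -_  = -ₚ_
    ; 0#  = 0ₚ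
    ; 1#  = 1ₚ
    ; isCommutativeRing = record
      { isRing = record
        { +-isAbelianGroup = record
          { isGroup = record
            { isMonoid = record
              { isSemigroup = record
                { isMagma = record
                  { isEquivalence = record
                    { refl  = equal λ f → refl
                    ; sym   = λ p → equal λ f → ≡.sym (p .pair f)
                    ; trans = ≋-trans
                    }
                  ; ∙-cong = +ₚ-cong
                  }
                ; assoc = λ X Y Z → equal λ f → ≡.cong ⟨ f ,_⟩ (List.++-assoc X Y Z)
                }
              ; identity = (λ X → equal λ f → refl) , (λ X → equal λ f → ≡.cong ⟨ f ,_⟩ (List.++-identityʳ X))
              }
            ; inverse = (λ X → ≋-trans (+ₚ-comm (-ₚ X) X) (-ₚ-inverseʳ X)) , -ₚ-inverseʳ
            ; ⁻¹-cong = -ₚ-cong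
            }
          ; comm = +ₚ-comm
          }
        ; *-cong = *ₚ-cong
        ; *-assoc = *ₚ-assoc
        ; *-identity = *ₚ-identityˡ , (λ X → ≋-trans (*ₚ-comm X 1ₚ) (*ₚ-identityˡ X))
        ; distrib = (λ X Y Z → ≋-trans (*ₚ-comm X (Y +ₚ Z)) (≋-trans (distribʳ X Y Z) (+ₚ-cong (*ₚ-comm Y X) (*ₚ-comm Z X)))) , distribʳ
        }
      ; *-comm = *ₚ-comm
      }
    }

  unit : Fin m → Exponent
  unit k = Vec.tabulate λ i → if does (i Fin.≟ k) then 1 else 0

  X : Fin m → Polynomial
  X i = (ℤ.1ℤ , unit i) ∷ []

  open Rows monoidRing X using (Word; weight; fillingSum; fillingSum-diagram; tableaux; one; ⟦_⟧)
  module Polynomials = ListSum monoidRing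

  content : Word → Exponent
  content []      = Vec.replicate m 0
  content (i ∷ u) = unit i ∙ content u

  pair-weight : ∀ f u → ⟨ f , weight u ⟩ ≡ f (content u)
  pair-weight f []      = ≡.trans (ℤ.+-identityʳ _) (ℤ.*-identityˡ _)
  pair-weight f (i ∷ u) = begin
    ⟨ f , X i *ₚ weight u ⟩                                     ≡⟨ pair-* f (X i) (weight u) ⟩
    ℤ.1ℤ ℤ.* ⟨ (λ e → f (unit i ∙ e)) , weight u ⟩ ℤ.+ ℤ.0ℤ     ≡⟨ ≡.trans (ℤ.+-identityʳ _) (ℤ.*-identityˡ _) ⟩
    ⟨ (λ e → f (unit i ∙ e)) , weight u ⟩                       ≡⟨ pair-weight (λ e → f (unit i ∙ e)) u ⟩
    f (unit i ∙ content u)                                      ∎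

  lookup-content : ∀ i u → lookup (content u) i ≡ length (filter (i Fin.≟_) u)
  lookup-content i []      = Vec.lookup-replicate i 0
  lookup-content i (k ∷ u) = begin
    lookup (unit k ∙ content u) i                                          ≡⟨ Vec.lookup-zipWith ℕ._+_ i (unit k) (content u) ⟩
    lookup (unit k) i ℕ.+ lookup (content u) i                             ≡⟨ ≡.cong₂ ℕ._+_ (Vec.lookup∘tabulate _ i) (lookup-content i u) ⟩
    (if does (i Fin.≟ k) then 1 else 0) ℕ.+ length (filter (i Fin.≟_) u)   ≡⟨ count ⟩
    length (filter (i Fin.≟_) (k ∷ u))                                     ∎
    where
    count : (if does (i Fin.≟ k) then 1 else 0) ℕ.+ length (filter (i Fin.≟_) u) ≡ length (filter (i Fin.≟_) (k ∷ u))
    count with does (i Fin.≟ k)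
    ... | true  = refl
    ... | false = refl

  pair-⟦⟧ : ∀ f b Y → ⟨ f , ⟦ b ⟧ *ₚ Y ⟩ ≡ (if b then ⟨ f , Y ⟩ else ℤ.0ℤ)
  pair-⟦⟧ f true  Y = *ₚ-identityˡ Y .pair f
  pair-⟦⟧ f false Y = refl

  pair-∑ : ∀ {A : Set} f (as : List A) g → ⟨ f , Polynomials.∑[ as ] g ⟩ ≡ ∑[ as ] (λ a → ⟨ f , g a ⟩)
  pair-∑ f []       g = refl
  pair-∑ f (a ∷ as) g = ≡.trans (pair-+ f (g a) _) (≡.cong (λ i → ⟨ f , g a ⟩ ℤ.+ i) (pair-∑ f as g))

  length-filter-∑ : ∀ {A : Set} {p} {P : Pred A p} (P? : Decidable P) as →
    ℤ.+ length (filter P? as) ≡ ∑[ as ] (λ a → if does (P? a) then ℤ.1ℤ else ℤ.0ℤ)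
  length-filter-∑ P? []       = refl
  length-filter-∑ P? (a ∷ as) with does (P? a)
  ... | true  = ≡.cong (λ i → ℤ.1ℤ ℤ.+ i) (length-filter-∑ P? as)
  ... | false = ≡.trans (length-filter-∑ P? as) (≡.sym (ℤ.+-identityˡ _))

coefficient : (w : Monomial) → MonoidRing.Exponent (length w) → ℤ
coefficient w e = if does (Fin.all? λ i → lookup e i ℕ.≟ List.lookup w i) then ℤ.1ℤ else ℤ.0ℤ

-- Take as many variables as `w` has entries. The semistandard test is a factor 0 or 1 in the
-- generating function and the content test is the functional, so their conjunction is counted.
schur-tableaux : ∀ w α β → Fits α β → let open MonoidRing (length w) in
  schur (α ∥ β) w ≡ ⟨ coefficient w , Rows.tableaux monoidRing X (Rows.one monoidRing X) α β ⟩
schur-tableaux w α β fits = begin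
  schur (α ∥ β) w
    ≡⟨ length-filter-∑ (λ T → semiStandard? D T ×-dec hasContent? w D T) (fillings (length w) D) ⟩
  ∑[ fillings (length w) D ] (λ T → if does (semiStandard? D T) ∧ does (hasContent? w D T) then ℤ.1ℤ else ℤ.0ℤ)
    ≡⟨ ∑-cong (fillings (length w) D) (λ T → ≡.sym (evaluate T)) ⟩
  -- The factor `1ₚ` is the trivial weight of the top row.
  ∑[ fillings (length w) D ] (λ T → ⟨ coefficient w , 1ₚ *ₚ (⟦ does (semiStandard? D T) ⟧ *ₚ weight (entries D T)) ⟩)
    ≡⟨ pair-∑ (coefficient w) (fillings (length w) D) _ ⟨
  ⟨ coefficient w , fillingSum one D ⟩
    ≡⟨ fillingSum-diagram α β fits .pair (coefficient w) ⟩
  ⟨ coefficient w , tableaux one α β ⟩ ∎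
  where
  open MonoidRing (length w)
  open Rows monoidRing X
  open ListSum ℤ.+-*-commutativeRing
  open ≡.≡-Reasoning
  D : Diagram
  D = diagram (α ∥ β)
  if-∧ : ∀ b c → (if b then (if c then ℤ.1ℤ else ℤ.0ℤ) else ℤ.0ℤ) ≡ (if b ∧ c then ℤ.1ℤ else ℤ.0ℤ)
  if-∧ true  c = refl
  if-∧ false c = refl
  evaluate : ∀ T → ⟨ coefficient w , 1ₚ *ₚ (⟦ does (semiStandard? D T) ⟧ *ₚ weight (entries D T)) ⟩
                   ≡ (if does (semiStandard? D T) ∧ does (hasContent? w D T) then ℤ.1ℤ else ℤ.0ℤ)
  evaluate T = begin
    ⟨ coefficient w , 1ₚ *ₚ (⟦ ss ⟧ *ₚ weight u) ⟩                   ≡⟨ *ₚ-identityˡ (⟦ ss ⟧ *ₚ weight u) .pair (coefficient w) ⟩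
    ⟨ coefficient w , ⟦ ss ⟧ *ₚ weight u ⟩                           ≡⟨ pair-⟦⟧ (coefficient w) ss (weight u) ⟩
    (if ss then ⟨ coefficient w , weight u ⟩ else ℤ.0ℤ)              ≡⟨ ≡.cong (λ i → if ss then i else ℤ.0ℤ) (pair-weight (coefficient w) u) ⟩
    (if ss then coefficient w (content u) else ℤ.0ℤ)                 ≡⟨ ≡.cong (λ b → if ss then (if b then ℤ.1ℤ else ℤ.0ℤ) else ℤ.0ℤ) same ⟩
    (if ss then (if does (hasContent? w D T) then ℤ.1ℤ else ℤ.0ℤ) else ℤ.0ℤ) ≡⟨ if-∧ ss (does (hasContent? w D T)) ⟩
    (if ss ∧ does (hasContent? w D T) then ℤ.1ℤ else ℤ.0ℤ)           ∎
    where
    ss = does (semiStandard? D T)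
    u  = entries D T
    same : does (Fin.all? λ i → lookup (content u) i ℕ.≟ List.lookup w i) ≡ does (hasContent? w D T)
    same = does-⇔ (mk⇔ (λ f i → ≡.trans (≡.sym (lookup-content i u)) (f i)) (λ f i → ≡.trans (lookup-content i u) (f i)))
                  (Fin.all? λ i → lookup (content u) i ℕ.≟ List.lookup w i) (hasContent? w D T)

-- The shapes of the theorem as coefficients of ribbon identities

open Defs using (_≈_)
open import Data.Nat.Base using (_+_; _*_; _∸_; _≤_; _<_; ⌊_/2⌋)

fits-++ : ∀ {S S̄ y ρ ρ̄} → Upper S S̄ → Fits S S̄ → 1 ≤ y → Fits (y ∷ ρ) ρ̄ → Fits (S ++ y ∷ ρ) (S̄ ++ ρ̄)
fits-++ []      _           1≤y fits = fits
fits-++ end     _           1≤y fits = 1≤y , fits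
fits-++ (b ∷ u) (b≤ , fitsS) 1≤y fits = b≤ , fits-++ u fitsS 1≤y fits

-- `Fits` bounds each overlap by the lower of its two rows, so the top row may change its length.
fits-head : ∀ {y z} ρ {ρ̄} → Fits (y ∷ ρ) ρ̄ → Fits (z ∷ ρ) ρ̄
fits-head []      _    = tt
fits-head (_ ∷ _) fits = fits

extend-fits : ∀ {S S̄} b → Upper S S̄ → Fits S S̄ → ∀ m → Fits (extend S (suc b) m) (extendOverlaps S̄ m)
extend-fits b u fits zero    = fits
extend-fits b u fits (suc m) =
  fits-++ {ρ = []} (extend-upper (suc b) u m) (extend-fits b u fits m) (ℕ.≤-trans (s≤s z≤n) (bump≥ m (suc b))) tt

fits-replicate : ∀ {T T̄} b → (∀ y → Fits (y ∷ T) T̄) → ∀ m y → Fits (y ∷ replicate m (suc b) ++ T) (replicate m 1 ++ T̄)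
fits-replicate b fitsT zero    y = fitsT y
fits-replicate b fitsT (suc m) y = s≤s z≤n , fits-replicate b fitsT m (suc b)

module Coefficients (w : Monomial) where
  open MonoidRing (length w)
  open Ribbons monoidRing X
  open Alternating monoidRing using (sumTo)
  open ≡.≡-Reasoning

  φ : Polynomial → ℤ
  φ = ⟨ coefficient w ,_⟩

  ≋-refl : ∀ {Y} → Y ≋ Y
  ≋-refl = equal λ f → refl

  schur-φ : ∀ {α β α′ β′ L} → α ≡ α′ → β ≡ β′ → Fits α′ β′ → F α′ β′ ≋ L → schur (α ∥ β) w ≡ φ L
  schur-φ {α} {β} refl refl fits eq = ≡.trans (schur-tableaux w α β fits) (eq .pair (coefficient w))

  ∑-sumTo : ∀ N (e : ℕ → ℕ) f g → (∀ j → j < N → schur (f (e j)) w ≡ φ (g j)) → ∑ (map f (applyUpTo e N)) w ≡ φ (sumTo N g)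
  ∑-sumTo zero    e f g eq = refl
  ∑-sumTo (suc N) e f g eq = ≡.trans
    (≡.cong₂ ℤ._+_ (eq 0 ℕ.z<s) (∑-sumTo N (λ j → e (suc j)) f (λ j → g (suc j)) λ j j<N → eq (suc j) (ℕ.s<s j<N)))
    (≡.sym (pair-+ (coefficient w) (g 0) _))

  sumTo-zero : ∀ N g → (∀ j → g j ≋ 0ₚ) → ℤ.0ℤ ≡ φ (sumTo N g)
  sumTo-zero zero    g eq = refl
  sumTo-zero (suc N) g eq = ≡.trans
    (≡.cong₂ ℤ._+_ (≡.sym (eq 0 .pair (coefficient w))) (sumTo-zero N (λ j → g (suc j)) (λ j → eq (suc j))))
    (≡.sym (pair-+ (coefficient w) (g 0) _))

  φ-difference : ∀ {p q} Y Z {L} → p ≡ φ Y → q ≡ φ Z → Y +ₚ (-ₚ Z) ≋ L → p ℤ.- q ≡ φ L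
  φ-difference Y Z refl refl eq =
    ≡.trans (≡.sym (≡.trans (pair-+ _ Y (-ₚ Z)) (≡.cong (λ i → φ Y ℤ.+ i) (pair-neg _ Z)))) (eq .pair (coefficient w))

  φ-sum : ∀ Y₁ Y₂ Y₃ Y₄ Y₅ {i₁ i₂ i₃ i₄ i₅} → i₁ ≡ φ Y₁ → i₂ ≡ φ Y₂ → i₃ ≡ φ Y₃ → i₄ ≡ φ Y₄ → i₅ ≡ φ Y₅ →
          φ (Y₁ +ₚ Y₂ +ₚ Y₃ +ₚ Y₄ +ₚ Y₅) ≡ i₁ ℤ.+ i₂ ℤ.+ i₃ ℤ.+ i₄ ℤ.+ i₅
  φ-sum Y₁ Y₂ Y₃ Y₄ Y₅ refl refl refl refl refl = ≡.trans (pair-+ _ (Y₁ +ₚ Y₂ +ₚ Y₃ +ₚ Y₄) Y₅)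
    (≡.cong (λ i → i ℤ.+ φ Y₅) (≡.trans (pair-+ _ (Y₁ +ₚ Y₂ +ₚ Y₃) Y₄)
    (≡.cong (λ i → i ℤ.+ φ Y₄) (≡.trans (pair-+ _ (Y₁ +ₚ Y₂) Y₃)
    (≡.cong (λ i → i ℤ.+ φ Y₃) (pair-+ _ Y₁ Y₂))))))

  ∑-then : ∀ {A B c i} → c ≡ true → schur A w ≡ i → ∑ [ (if c then A else B) ] w ≡ i
  ∑-then refl eq = ≡.trans (ℤ.+-identityʳ _) eq

  ∑-else : ∀ {A B c i} → c ≡ false → schur B w ≡ i → ∑ [ (if c then A else B) ] w ≡ i
  ∑-else refl eq = ≡.trans (ℤ.+-identityʳ _) eq

  module Lines {S S̄ T T̄ : List ℕ} (upper : Upper S S̄) (fitsS : Fits S S̄)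
               (T̄≤1 : head₀ T̄ ≤ 1) (fitsT : ∀ y → Fits (y ∷ T) T̄) (b : ℕ) where
    open Families {T = T} {T̄} upper T̄≤1 b public

    1+v⁰ : ∀ k → v⁰ k + 1 ≡ suc (v⁰ k)
    1+v⁰ k = ℕ.+-comm (v⁰ k) 1

    v⁻-suc : ∀ k → (suc k + 1) * a ∸ 1 ≡ v⁻ (suc k)
    v⁻-suc k = ≡.cong (λ i → suc i * a ∸ 1) (ℕ.+-comm k 1)

    fitsR : ∀ m y → Fits (y ∷ replicate m a ++ T) (replicate m 1 ++ T̄)
    fitsR = fits-replicate (suc b) fitsT

    minuend : ∀ m → schur (S ++ replicate (suc (suc m)) a ++ T ∥ S̄ ++ replicate (suc m) 1 ++ T̄) w ≡ φ (P⁰ 0 (suc m))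
    minuend m = schur-φ {L = P⁰ 0 (suc m)} (≡.cong (λ y → S ++ y ∷ replicate (suc m) a ++ T) (≡.sym v⁰0)) refl
      (fits-++ upper fitsS (s≤s z≤n) (fitsR (suc m) (v⁰ 0))) ≋-refl

    subtrahend : ∀ m → schur (S ++ a + 1 ∷ replicate m a ++ a ∸ 1 ∷ T ∥ S̄ ++ replicate (suc m) 1 ++ T̄) w ≡ φ (Q⁻ 0 (suc m))
    subtrahend m = schur-φ {L = Q⁻ 0 (suc m)} shape (≡.sym (extendOverlaps-++ S̄ (suc m) T̄))
      (fits-++ (extend-upper a upper (suc m)) (extend-fits (suc b) upper fitsS (suc m)) (s≤s z≤n) (fitsT (v⁻ 0))) ≋-refl
      where
      shape : S ++ a + 1 ∷ replicate m a ++ a ∸ 1 ∷ T ≡ U (suc m) ++ v⁻ 0 ∷ T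
      shape = ≡.trans
        (≡.cong₂ (λ y z → S ++ y ∷ replicate m a ++ z ∷ T) (ℕ.+-comm a 1) (≡.cong (_∸ 1) (≡.sym v⁰0)))
        (≡.sym (extend-++ S a m (v⁻ 0 ∷ T)))

    line₁ : ∀ n {M N} → M ≡ N → ∑ (terms M λ k → S ++ k * a ∷ k * a ∷ replicate (n ∸ 2 * k) a ++ T
                                                   ∥ S̄ ++ k * a ∷ replicate (n ∸ 2 * k) 1 ++ T̄) w
                    ≡ φ (sumTo N (l₁ n))
    line₁ n {N = N} refl = ∑-sumTo N suc _ _ λ j _ → schur-φ refl refl
      (fits-++ upper fitsS (s≤s z≤n) (ℕ.≤-refl , fitsR (n ∸ 2 * suc j) (v⁰ j))) (L₁-shape j (n ∸ 2 * suc j))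

    line₃ : ∀ n {M N} → M ≡ N → ∑ (terms M λ k → S ++ k * a + 1 ∷ (k + 1) * a ∸ 1 ∷ replicate (n ∸ 2 * k ∸ 1) a ++ T
                                       ∥ S̄ ++ k * a + 1 ∷ replicate (n ∸ 2 * k ∸ 1) 1 ++ T̄) w
                    ≡ φ (sumTo N (l₃ n))
    line₃ n {N = N} refl = ∑-sumTo N suc _ _ λ j _ → let i = n ∸ 2 * suc j ∸ 1 in schur-φ
      (≡.cong₂ (λ y z → S ++ y ∷ z ∷ replicate i a ++ T) (1+v⁰ j) (v⁻-suc j))
      (≡.cong (λ y → S̄ ++ y ∷ replicate i 1 ++ T̄) (1+v⁰ j))
      (fits-++ upper fitsS (s≤s z≤n) (s≤s (ℕ.m≤n+m (v⁰ j) b) , fitsR i (v⁻ (suc j)))) (L₃-shape j i)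

    identity-even : ∀ N {n p q i₁ i₂ i₃ i₄ i₅} → n ≡ suc (suc (double N + 0)) → p ≡ φ (P⁰ 0 (n ∸ 1)) → q ≡ φ (Q⁻ 0 (n ∸ 1)) →
      i₁ ≡ φ (sumTo (suc N) (l₁ n)) → i₂ ≡ φ (sumTo N (l₂ n)) → i₃ ≡ φ (sumTo N (l₃ n)) → i₄ ≡ φ (sumTo N (l₄ n)) →
      i₅ ≡ φ (L₂ N 0) → p ℤ.- q ≡ i₁ ℤ.+ i₂ ℤ.+ i₃ ℤ.+ i₄ ℤ.+ i₅
    identity-even N {n} n≡ p≡ q≡ e₁ e₂ e₃ e₄ e₅ = ≡.trans
      (φ-difference (P⁰ 0 (n ∸ 1)) (Q⁻ 0 (n ∸ 1)) p≡ q≡ (difference-even N n≡))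
      (φ-sum (sumTo (suc N) (l₁ n)) (sumTo N (l₂ n)) (sumTo N (l₃ n)) (sumTo N (l₄ n)) (L₂ N 0) e₁ e₂ e₃ e₄ e₅)

    identity-odd : ∀ N {n p q i₁ i₂ i₃ i₄ i₅} → n ≡ suc (suc (double N + 1)) → p ≡ φ (P⁰ 0 (n ∸ 1)) → q ≡ φ (Q⁻ 0 (n ∸ 1)) →
      i₁ ≡ φ (sumTo (suc N) (l₁ n)) → i₂ ≡ φ (sumTo (suc N) (l₂ n)) → i₃ ≡ φ (sumTo (suc N) (l₃ n)) → i₄ ≡ φ (sumTo N (l₄ n)) →
      i₅ ≡ φ (L₄ N 0) → p ℤ.- q ≡ i₁ ℤ.+ i₂ ℤ.+ i₃ ℤ.+ i₄ ℤ.+ i₅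
    identity-odd N {n} n≡ p≡ q≡ e₁ e₂ e₃ e₄ e₅ = ≡.trans
      (φ-difference (P⁰ 0 (n ∸ 1)) (Q⁻ 0 (n ∸ 1)) p≡ q≡ (difference-odd N n≡))
      (φ-sum (sumTo (suc N) (l₁ n)) (sumTo (suc N) (l₂ n)) (sumTo (suc N) (l₃ n)) (sumTo N (l₄ n)) (L₄ N 0) e₁ e₂ e₃ e₄ e₅)

  module LowerLines {S S̄ T T̄ : List ℕ} {τ τ̄ : ℕ} (upper : Upper S S̄) (fitsS : Fits S S̄)
                    (τ̄≡1 : τ̄ ≡ 1) (1≤τ : 1 ≤ τ) (T̄≤τ : head₀ T̄ ≤ τ) (fitsT : Fits (τ ∷ T) T̄) (b : ℕ) where
    open Lines {T = τ ∷ T} {τ̄ ∷ T̄} upper fitsS (ℕ.≤-reflexive τ̄≡1)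
      (λ y → ℕ.≤-trans (ℕ.≤-reflexive τ̄≡1) 1≤τ , fitsT) b public
    open WithLower {T = T} {T̄} upper τ̄≡1 1≤τ T̄≤τ b

    schur-L₂ : ∀ {α β} k m → α ≡ U m ++ bump m (v⁰ k) ∷ v⁻ k + τ ∷ T → β ≡ Ū m ++ v⁰ k ∷ T̄ → schur (α ∥ β) w ≡ φ (L₂ k m)
    schur-L₂ k m α≡ β≡ = schur-φ α≡ β≡
      (fits-++ (extend-upper a upper m) (extend-fits (suc b) upper fitsS m) (ℕ.≤-trans (s≤s z≤n) (bump≥ m (v⁰ k)))
        (ℕ.≤-trans (ℕ.≤-reflexive (ℕ.+-comm 1 (v⁻ k))) (ℕ.+-monoʳ-≤ (v⁻ k) 1≤τ) , fits-head T fitsT))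
      (L₂-shape k m)

    schur-L₄ : ∀ {α β} k m → α ≡ U m ++ bump m (v⁻ (suc k)) ∷ v⁰ k + τ ∷ T → β ≡ Ū m ++ suc (v⁰ k) ∷ T̄ → schur (α ∥ β) w ≡ φ (L₄ k m)
    schur-L₄ k m α≡ β≡ = schur-φ α≡ β≡
      (fits-++ (extend-upper a upper m) (extend-fits (suc b) upper fitsS m) (ℕ.≤-trans (s≤s z≤n) (bump≥ m (v⁻ (suc k))))
        (ℕ.≤-trans (ℕ.≤-reflexive (ℕ.+-comm 1 (v⁰ k))) (ℕ.+-monoʳ-≤ (v⁰ k) 1≤τ) , fits-head T fitsT))
      (L₄-shape k m)

    -- Positivity of n - 2k ensures that a separate row of length a + 1 stands above the long row;
    -- for n - 2k = 0 the extra box would go to the long row, as in the final line.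
    line₂ : ∀ n {M N} → M ≡ N → (∀ j → j < N → ∃ λ i → n ∸ 2 * suc j ≡ suc i) →
            ∑ (terms M λ k → S ++ a + 1 ∷ replicate (n ∸ 2 * k ∸ 1) a ++ k * a ∷ k * a ∸ 1 + τ ∷ T
                               ∥ S̄ ++ replicate (n ∸ 2 * k) 1 ++ k * a ∷ T̄) w
            ≡ φ (sumTo N (l₂ n))
    line₂ n {N = N} refl positive = ∑-sumTo N suc _ _ λ j j<N → term₂ j (n ∸ 2 * suc j) (positive j j<N)
      where
      term₂ : ∀ j l → (∃ λ i → l ≡ suc i) →
              schur (S ++ a + 1 ∷ replicate (l ∸ 1) a ++ v⁰ j ∷ v⁻ j + τ ∷ T ∥ S̄ ++ replicate l 1 ++ v⁰ j ∷ T̄) w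
              ≡ φ (L₂ j l)
      term₂ j _ (i , refl) = schur-L₂ j (suc i)
        (≡.trans (≡.cong (λ y → S ++ y ∷ replicate i a ++ v⁰ j ∷ v⁻ j + τ ∷ T) (ℕ.+-comm a 1)) (≡.sym (extend-++ S a i _)))
        (≡.sym (extendOverlaps-++ S̄ (suc i) _))

    line₄ : ∀ n {M N} → M ≡ N → (∀ j → j < N → ∃ λ i → n ∸ 2 * suc j ≡ suc (suc i)) →
            ∑ (terms M λ k → S ++ a + 1 ∷ replicate (n ∸ 2 * k ∸ 2) a ++ (k + 1) * a ∸ 1 ∷ k * a + τ ∷ T
                               ∥ S̄ ++ replicate (n ∸ 2 * k ∸ 1) 1 ++ k * a + 1 ∷ T̄) w
            ≡ φ (sumTo N (l₄ n))
    line₄ n {N = N} refl positive = ∑-sumTo N suc _ _ λ j j<N → term₄ j (n ∸ 2 * suc j) (positive j j<N)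
      where
      term₄ : ∀ j l → (∃ λ i → l ≡ suc (suc i)) →
              schur (S ++ a + 1 ∷ replicate (l ∸ 2) a ++ (suc j + 1) * a ∸ 1 ∷ v⁰ j + τ ∷ T ∥ S̄ ++ replicate (l ∸ 1) 1 ++ v⁰ j + 1 ∷ T̄) w
              ≡ φ (L₄ j (l ∸ 1))
      term₄ j _ (i , refl) = schur-L₄ j (suc i)
        (≡.trans (≡.cong₂ (λ y z → S ++ y ∷ replicate i a ++ z ∷ v⁰ j + τ ∷ T) (ℕ.+-comm a 1) (v⁻-suc j)) (≡.sym (extend-++ S a i _)))
        (≡.trans (≡.cong (λ y → S̄ ++ replicate (suc i) 1 ++ y ∷ T̄) (1+v⁰ j)) (≡.sym (extendOverlaps-++ S̄ (suc i) _)))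

    line₅-even : ∀ N {i} → i ≡ suc N →
      schur (S ++ i * a + 1 ∷ i * a ∸ 1 + τ ∷ T ∥ S̄ ++ i * a ∷ T̄) w ≡ φ (L₂ N 0)
    line₅-even N refl = schur-L₂ N 0 (≡.cong (λ y → S ++ y ∷ v⁻ N + τ ∷ T) (1+v⁰ N)) refl

    line₅-odd : ∀ N {i i′} → i ≡ suc (suc N) → i′ ≡ suc N →
      schur (S ++ i * a ∷ i′ * a + τ ∷ T ∥ S̄ ++ i′ * a + 1 ∷ T̄) w ≡ φ (L₄ N 0)
    line₅-odd N refl refl = schur-L₄ N 0 refl (≡.cong (λ y → S̄ ++ y ∷ T̄) (1+v⁰ N))

-- Parity, floors and the number of terms

double≡2* : ∀ N → double N ≡ 2 * N
double≡2* zero    = refl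
double≡2* (suc N) = ≡.trans (≡.cong (λ i → suc (suc i)) (double≡2* N)) (≡.sym (ℕ.*-suc 2 N))

parity : ∀ n → (∃ λ N → n ≡ double N + 0) ⊎ (∃ λ N → n ≡ double N + 1)
parity zero    = inj₁ (0 , refl)
parity (suc n) with parity n
... | inj₁ (N , refl) = inj₂ (N , ≡.sym (ℕ.+-suc (double N) 0))
... | inj₂ (N , refl) = inj₁ (suc N , ≡.cong suc (ℕ.+-suc (double N) 0))

⌊double+0/2⌋ : ∀ N → ⌊ double N + 0 /2⌋ ≡ N
⌊double+0/2⌋ zero    = refl
⌊double+0/2⌋ (suc N) = ≡.cong suc (⌊double+0/2⌋ N)

⌊double+1/2⌋ : ∀ N → ⌊ double N + 1 /2⌋ ≡ N
⌊double+1/2⌋ zero    = refl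
⌊double+1/2⌋ (suc N) = ≡.cong suc (⌊double+1/2⌋ N)

⌊1+double+0/2⌋ : ∀ N → ⌊ suc (double N + 0) /2⌋ ≡ N
⌊1+double+0/2⌋ zero    = refl
⌊1+double+0/2⌋ (suc N) = ≡.cong suc (⌊1+double+0/2⌋ N)

⌊1+double+1/2⌋ : ∀ N → ⌊ suc (double N + 1) /2⌋ ≡ suc N
⌊1+double+1/2⌋ zero    = refl
⌊1+double+1/2⌋ (suc N) = ≡.cong suc (⌊1+double+1/2⌋ N)

2∣double : ∀ N → 2 ∣ suc (suc (double N + 0))
2∣double N = divides (suc N) (≡.cong (λ i → suc (suc i)) (≡.trans (ℕ.+-identityʳ _) (≡.trans (double≡2* N) (ℕ.*-comm 2 N))))

2∤1+double : ∀ N → ¬ (2 ∣ suc (suc (double N + 1)))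
2∤1+double N (divides q eq) = ℕ.even≢odd q (suc N) (≡.trans (ℕ.*-comm 2 q) (≡.trans (≡.sym eq)
  (≡.cong suc (≡.trans (≡.cong suc (≡.trans (ℕ.+-comm (double N) 1) (≡.cong suc (double≡2* N)))) (≡.sym (ℕ.*-suc 2 N))))))

total : ∀ n → suc ⌊ n /2⌋ + (⌊ suc n /2⌋ + (⌊ suc n /2⌋ + (⌊ n /2⌋ + 1))) ≡ 2 * suc (suc n) ∸ 2
total n = ≡.trans (rearrange ⌊ n /2⌋ ⌊ suc n /2⌋) (≡.cong (λ i → 2 * suc (suc i) ∸ 2) (ℕ.⌊n/2⌋+⌈n/2⌉≡n n))
  where
  -- The right-hand side is what `2 * suc (suc i) ∸ 2` computes to at `i = f + c`.
  rearrange : ∀ f c → suc f + (c + (c + (f + 1))) ≡ (f + c) + (suc (suc (f + c)) + 0)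
  rearrange = solve-∀

-- For odd n the second sum has the additional index j = N, where exactly one row is left.
remainder-odd : ∀ N j → j < suc N → ∃ λ i → suc (suc (double N + 1)) ∸ 2 * suc j ≡ suc i
remainder-odd N j (s≤s j≤N) with ℕ.m≤n⇒m<n∨m≡n j≤N
... | inj₁ j<N  = let i , eq = remainder-≥2 N 1 j j<N in suc i , eq
... | inj₂ refl = 0 , remainder-last N 1

length-terms-++ : ∀ N f Ss → length (terms N f ++ Ss) ≡ N + length Ss
length-terms-++ N f Ss = ≡.trans (List.length-++ (terms N f))
  (≡.cong (_+ length Ss) (≡.trans (List.length-map f (applyUpTo suc N)) (List.length-applyUpTo suc N)))

-- The Standing Hypothesis in terms of lists

upper-vec : ∀ {s} (σ σ̄ : Vec ℕ s) → (∀ i → suc (toℕ i) ≡ s → lookup σ̄ i ≡ 1) → Upper (toList σ) (toList σ̄)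
upper-vec []           []           last≡1 = []
upper-vec (s ∷ [])     (b ∷ [])     last≡1 with refl ← last≡1 Fin.zero refl = end
upper-vec (s ∷ s′ ∷ σ) (b ∷ b′ ∷ σ̄) last≡1 = b ∷ upper-vec (s′ ∷ σ) (b′ ∷ σ̄) λ i eq → last≡1 (Fin.suc i) (≡.cong suc eq)

fits-above : ∀ {s} (σ σ̄ : Vec ℕ s) → (∀ i j → toℕ j ≡ suc (toℕ i) → lookup σ̄ i ≤ lookup σ j) → Fits (toList σ) (toList σ̄)
fits-above []           []           bound = tt
fits-above (s ∷ [])     (b ∷ [])     bound = tt
fits-above (s ∷ s′ ∷ σ) (b ∷ b′ ∷ σ̄) bound =
  bound Fin.zero (Fin.suc Fin.zero) refl , fits-above (s′ ∷ σ) (b′ ∷ σ̄) λ i j eq → bound (Fin.suc i) (Fin.suc j) (≡.cong suc eq)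

fits-below : ∀ {t} (τ τ̄ : Vec ℕ t) → (∀ i → lookup τ̄ i ≤ lookup τ i) → ∀ y → Fits (y ∷ toList τ) (toList τ̄)
fits-below []       []       bound y = tt
fits-below (τ₁ ∷ τ) (b ∷ τ̄) bound y = bound Fin.zero , fits-below τ τ̄ (λ i → bound (Fin.suc i)) τ₁

head₀-bound : ∀ {t} (τ̄ : Vec ℕ t) {k} → (∀ i → toℕ i ≡ 0 → lookup τ̄ i ≤ k) → head₀ (toList τ̄) ≤ k
head₀-bound []      bound = z≤n
head₀-bound (b ∷ τ̄) bound = bound Fin.zero refl

theorem2p13 :
  ∀ (s t : ℕ) (σ σ̄ : Vec ℕ s) (τ τ̄ : Vec ℕ t) → Hypothesis σ σ̄ τ τ̄ →
  ∀ (a n : ℕ) → 2 ≤ a → 2 ≤ n →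
  let
    S  = toList σ
    S̄  = toList σ̄
    T  = toList τ
    T̄  = toList τ̄
    T̄′ = drop 1 T̄

    line₁ = terms ⌊ n /2⌋ λ k →
      S ++ k * a ∷ k * a ∷ replicate (n ∸ 2 * k) a ++ T
        ∥ S̄ ++ k * a ∷ replicate (n ∸ 2 * k) 1 ++ T̄

    line₂ = withFirst τ λ τ₁ T′ → terms ⌊ n ∸ 1 /2⌋ λ k →
      S ++ a + 1 ∷ replicate (n ∸ 2 * k ∸ 1) a ++ k * a ∷ k * a ∸ 1 + τ₁ ∷ T′
        ∥ S̄ ++ replicate (n ∸ 2 * k) 1 ++ k * a ∷ T̄′

    line₃ = terms ⌊ n ∸ 1 /2⌋ λ k →
      S ++ k * a + 1 ∷ (k + 1) * a ∸ 1 ∷ replicate (n ∸ 2 * k ∸ 1) a ++ T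
        ∥ S̄ ++ k * a + 1 ∷ replicate (n ∸ 2 * k ∸ 1) 1 ++ T̄

    line₄ = withFirst τ λ τ₁ T′ → terms ⌊ n ∸ 2 /2⌋ λ k →
      S ++ a + 1 ∷ replicate (n ∸ 2 * k ∸ 2) a ++ (k + 1) * a ∸ 1 ∷ k * a + τ₁ ∷ T′
        ∥ S̄ ++ replicate (n ∸ 2 * k ∸ 1) 1 ++ k * a + 1 ∷ T̄′

    line₅ = withFirst τ λ τ₁ T′ → [ (if does (2 ∣? n)
      then (S ++ ⌊ n /2⌋ * a + 1 ∷ ⌊ n /2⌋ * a ∸ 1 + τ₁ ∷ T′
              ∥ S̄ ++ ⌊ n /2⌋ * a ∷ T̄′)
      else (S ++ ⌊ n + 1 /2⌋ * a ∷ ⌊ n ∸ 1 /2⌋ * a + τ₁ ∷ T′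
              ∥ S̄ ++ ⌊ n ∸ 1 /2⌋ * a + 1 ∷ T̄′)) ]

    number-of-terms = length (line₁ ++ line₂ ++ line₃ ++ line₄ ++ line₅)
  in
  (schur (S ++ replicate n a ++ T ∥ S̄ ++ replicate (n ∸ 1) 1 ++ T̄)
     ⊖ schur (S ++ a + 1 ∷ replicate (n ∸ 2) a ++ a ∸ 1 ∷ T ∥ S̄ ++ replicate (n ∸ 1) 1 ++ T̄)
   ≈ ∑ line₁ ⊕ ∑ line₂ ⊕ ∑ line₃ ⊕ ∑ line₄ ⊕ ∑ line₅)
  × (0 < t → number-of-terms ≡ 2 * n ∸ 2)
  × (t ≡ 0 → number-of-terms ≡ n ∸ 1)
theorem2p13 s zero σ σ̄ [] [] hyp (suc (suc b)) (suc (suc n′)) (s≤s (s≤s _)) (s≤s (s≤s _)) =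
  identity , (λ ()) , λ _ → count
  where
  open Hypothesis hyp
  n = suc (suc n′)
  upper = upper-vec σ σ̄ σ̄-last
  fitsS = fits-above σ σ̄ (λ i j eq → ℕ.≤-trans (σ̄-bound i j eq) (ℕ.m⊓n≤n (lookup σ i) (lookup σ j)))
  identity : _ ≈ _
  identity w = case parity n′ of λ where
      (inj₁ (N , refl)) → identity-even N refl (minuend n′) (subtrahend n′)
        (line₁ n (≡.cong suc (⌊double+0/2⌋ N)))
        -- The lines with τ are empty lists here, and the corresponding parts of the telescope
        -- vanish term by term.
        (sumTo-zero N (l₂ n) λ j → L₂-zero j (n ∸ 2 * suc j))
        (line₃ n (⌊1+double+0/2⌋ N))
        (sumTo-zero N (l₄ n) λ j → L₄-zero j (n ∸ 2 * suc j ∸ 1))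
        (≡.sym (L₂-zero N 0 .pair (coefficient w)))
      (inj₂ (N , refl)) → identity-odd N refl (minuend n′) (subtrahend n′)
        (line₁ n (≡.cong suc (⌊double+1/2⌋ N)))
        (sumTo-zero (suc N) (l₂ n) λ j → L₂-zero j (n ∸ 2 * suc j))
        (line₃ n (⌊1+double+1/2⌋ N))
        (sumTo-zero N (l₄ n) λ j → L₄-zero j (n ∸ 2 * suc j ∸ 1))
        (≡.sym (L₄-zero N 0 .pair (coefficient w)))
    where
    open MonoidRing (length w) using (pair; monoidRing; X)
    open Coefficients w
    open Lines {T = []} {[]} upper fitsS z≤n (λ y → tt) b
    open Ribbons.WithoutLower monoidRing X upper b
  count = ≡.trans (length-terms-++ ⌊ n /2⌋ _ _) (≡.trans (≡.cong (⌊ n /2⌋ +_) (length-terms-++ ⌊ suc n′ /2⌋ _ []))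
    (≡.trans (≡.cong (suc ⌊ n′ /2⌋ +_) (ℕ.+-identityʳ ⌊ suc n′ /2⌋)) (≡.cong suc (ℕ.⌊n/2⌋+⌈n/2⌉≡n n′))))
theorem2p13 s (suc t) σ σ̄ (τ₁ ∷ τ) (τ̄₁ ∷ τ̄) hyp (suc (suc b)) (suc (suc n′)) (s≤s (s≤s _)) (s≤s (s≤s _)) =
  identity , (λ _ → count) , λ ()
  where
  open Hypothesis hyp
  n = suc (suc n′)
  upper = upper-vec σ σ̄ σ̄-last
  fitsS = fits-above σ σ̄ (λ i j eq → ℕ.≤-trans (σ̄-bound i j eq) (ℕ.m⊓n≤n (lookup σ i) (lookup σ j)))
  τ̄≤τ₁ : head₀ (toList τ̄) ≤ τ₁
  τ̄≤τ₁ = head₀-bound τ̄ λ i i≡0 → ℕ.≤-trans (τ̄-bound (Fin.suc i) Fin.zero (≡.cong suc i≡0)) (ℕ.m⊓n≤n (lookup τ i) τ₁)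
  fitsT : Fits (τ₁ ∷ toList τ) (toList τ̄)
  fitsT = fits-below τ τ̄ (λ i → ℕ.≤-trans
    -- `Fin.inject₁ i` is the position in `τ₁ ∷ τ` directly before that of `Fin.suc i`.
    (τ̄-bound (Fin.suc i) (Fin.inject₁ i) (≡.cong suc (≡.sym (Fin.toℕ-inject₁ i))))
    (ℕ.m⊓n≤m (lookup τ i) (lookup (τ₁ ∷ τ) (Fin.inject₁ i)))) τ₁
  identity : _ ≈ _
  identity w = case parity n′ of λ where
      (inj₁ (N , refl)) → identity-even N refl (minuend n′) (subtrahend n′)
        (line₁ n (≡.cong suc (⌊double+0/2⌋ N)))
        (line₂ n (⌊1+double+0/2⌋ N) λ j j<N → let i , eq = remainder-≥2 N 0 j j<N in suc i , eq)
        (line₃ n (⌊1+double+0/2⌋ N))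
        (line₄ n (⌊double+0/2⌋ N) (remainder-≥2 N 0))
        (∑-then (dec-true (2 ∣? n) (2∣double N)) (line₅-even N (≡.cong suc (⌊double+0/2⌋ N))))
      (inj₂ (N , refl)) → identity-odd N refl (minuend n′) (subtrahend n′)
        (line₁ n (≡.cong suc (⌊double+1/2⌋ N)))
        (line₂ n (⌊1+double+1/2⌋ N) (remainder-odd N))
        (line₃ n (⌊1+double+1/2⌋ N))
        (line₄ n (⌊double+1/2⌋ N) (remainder-≥2 N 1))
        (∑-else (dec-false (2 ∣? n) (2∤1+double N))
          (line₅-odd N (≡.trans (≡.cong ⌊_/2⌋ (ℕ.+-comm n 1)) (≡.cong suc (⌊1+double+1/2⌋ N))) (⌊1+double+1/2⌋ N)))
    where
    open Coefficients w
    open LowerLines {T = toList τ} {toList τ̄} upper fitsS (τ̄-first Fin.zero refl) (τ-positive Fin.zero) τ̄≤τ₁ fitsT b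
  count = ≡.trans (length-terms-++ ⌊ n /2⌋ _ _) (≡.trans (≡.cong (⌊ n /2⌋ +_)
    (≡.trans (length-terms-++ ⌊ suc n′ /2⌋ _ _) (≡.cong (⌊ suc n′ /2⌋ +_)
    (≡.trans (length-terms-++ ⌊ suc n′ /2⌋ _ _) (≡.cong (⌊ suc n′ /2⌋ +_) (length-terms-++ ⌊ n′ /2⌋ _ _)))))) (total n′))
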